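{- Let $R$ be a principal ideal domain and let $I=gR\subsetneq R$ be a proper, non-prime ideal such that $Q:=R/I$ is finite. Write $g=u\cdot\prod_{i=1}^n p_i^{m_i}$ with $u$ a unit, $p_1,\dots,p_n$ pairwise non-associated prime elements and integers $m_1,\dots,m_n\ge 1$. Suppose $n\ge 2$. Then the zero divisor graph $\Gamma(Q)$ satisfies \[\dim_{TH}(\Gamma(Q))=\begin{cases} n & \text{if there is } i\in[n] \text{ with } m_i\ge 2,\\ n & \text{if } |R/p_iR|\ge 3 \text{ for all } i\in[n],\\ n-1 & \text{if } n\ge 3,\ m_i=1 \text{ for all } i\in[n], \text{ and there is } i\in[n] \text{ with } |R/p_iR|=2,\\ 1 & \text{if } n=2,\ m_1=m_2=1, \text{ and there is exactly one } i\in\{1,2\} \text{ with } |R/p_iR|=2,\\ 0 & \text{if } n=2,\ m_1=m_2=1 \text{ and } |R/p_1R|=|R/p_2R|=2. \end{cases}\]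
   Context: $[n]=\{1,\dots,n\}$. Rings are commutative and non-zero with $1$. For a ring $Q$, $Z(Q)$ is the set of $r\in Q$ for which there is $s\in Q\setminus\{0\}$ with $rs=0$. The zero divisor graph $\Gamma(Q)$ has vertex set $Z(Q)\setminus\{0\}$; two distinct vertices $r,s$ are adjacent iff $rs=0$. For a finite set $V$, $\alpha\colon V\to\mathbb{R}$ and $S\in\mathbb{R}$, the threshold graph $T(\alpha,S)$ has vertex set $V$ and edges all $\{v,w\}$, $v\neq w$, with $\alpha(v)+\alpha(w)\ge S$; a graph is a threshold graph if it is of this form. The threshold dimension $\dim_{TH}(G)$ of a finite simple graph $G$ is the minimum $d\ge 0$ such that there exist $d$ threshold graphs $H_1,\dots,H_d$ on $V(G)$ with $E(G)=\bigcap_{j=1}^d E(H_j)$; the empty intersection ($d=0$) is the set of all pairs of vertices, so $\dim_{TH}(G)=0$ iff $G$ is complete. -}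

module Defs where

open import Algebra.Bundles using (CommutativeRing; Semiring)
import Algebra.Definitions.RawSemiring as RawSemiringDefinitions
open import Data.Fin.Base using (Fin)
open import Data.Nat.Base as ℕ using (ℕ)
import Data.Nat.Properties as ℕ
open import Data.Product.Base using (∃; _×_; _,_; proj₁; proj₂; swap)
open import Data.Rational.Base as ℚ using (ℚ; 0ℚ; ½; ∣_∣)
import Data.Rational.Properties as ℚ
open import Data.Rational.Solver using (module +-*-Solver)
open import Data.Sum.Base using (_⊎_)
open import Function.Bundles using (Func; Injection; Inverse; _⇔_)
open import Level using (Level; _⊔_; suc; 0ℓ)
open import Relation.Binary.Bundles using (Setoid)
open import Relation.Binary.Core using (Rel)
open import Relation.Binary.Definitions using (Irreflexive; Symmetric; _Respects_; _Respects₂_)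
open import Relation.Binary.PropositionalEquality.Core as ≡ using (_≡_)
import Relation.Binary.PropositionalEquality.Properties as ≡
open import Relation.Nullary.Negation.Core using (¬_)
open import Relation.Unary using (Pred; _∈_; _≐_)

private
  variable
    a b c e ℓ : Level

-- Cauchy sequences of rationals; two sequences represent the same real
-- number when they are related by _≃_.
record ℝ : Set where
  field
    seq    : ℕ → ℚ
    cauchy : ∀ ε → 0ℚ ℚ.< ε →
             ∃ λ N → ∀ m n → N ℕ.≤ m → N ℕ.≤ n → ∣ seq m ℚ.- seq n ∣ ℚ.< ε

open ℝ

infix 4 _≤_ _≃_

_≤_ : Rel ℝ 0ℓ
x ≤ y = ∀ ε → 0ℚ ℚ.< ε → ∃ λ N → ∀ n → N ℕ.≤ n → seq x n ℚ.≤ seq y n ℚ.+ ε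

_≃_ : Rel ℝ 0ℓ
x ≃ y = x ≤ y × y ≤ x

private
  half-pos : ∀ {ε} → 0ℚ ℚ.< ε → 0ℚ ℚ.< ε ℚ.* ½
  half-pos 0<ε = ℚ.*-monoˡ-<-pos ½ 0<ε

  half+half : ∀ ε → ε ℚ.* ½ ℚ.+ ε ℚ.* ½ ≡ ε
  half+half ε = ≡.trans (≡.sym (ℚ.*-distribˡ-+ ε ½ ½)) (ℚ.*-identityʳ ε)

  ⊔-boundˡ : ∀ {M N n} → M ℕ.⊔ N ℕ.≤ n → M ℕ.≤ n
  ⊔-boundˡ = ℕ.≤-trans (ℕ.m≤m⊔n _ _)

  ⊔-boundʳ : ∀ {M N n} → M ℕ.⊔ N ℕ.≤ n → N ℕ.≤ n
  ⊔-boundʳ = ℕ.≤-trans (ℕ.m≤n⊔m _ _)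

infixl 6 _+_

_+_ : ℝ → ℝ → ℝ
(x + y) .seq n = seq x n ℚ.+ seq y n
(x + y) .cauchy ε 0<ε
  with cauchy x (ε ℚ.* ½) (half-pos 0<ε) | cauchy y (ε ℚ.* ½) (half-pos 0<ε)
... | M , x-close | N , y-close = M ℕ.⊔ N , λ m n m≥ n≥ → begin-strict
  ∣ (seq x m ℚ.+ seq y m) ℚ.- (seq x n ℚ.+ seq y n) ∣
    ≡⟨ ≡.cong ∣_∣ (rearrange (seq x m) (seq y m) (seq x n) (seq y n)) ⟩
  ∣ (seq x m ℚ.- seq x n) ℚ.+ (seq y m ℚ.- seq y n) ∣
    ≤⟨ ℚ.∣p+q∣≤∣p∣+∣q∣ (seq x m ℚ.- seq x n) (seq y m ℚ.- seq y n) ⟩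
  ∣ seq x m ℚ.- seq x n ∣ ℚ.+ ∣ seq y m ℚ.- seq y n ∣
    <⟨ ℚ.+-mono-< (x-close m n (⊔-boundˡ m≥) (⊔-boundˡ n≥))
                  (y-close m n (⊔-boundʳ m≥) (⊔-boundʳ n≥)) ⟩
  ε ℚ.* ½ ℚ.+ ε ℚ.* ½
    ≡⟨ half+half ε ⟩
  ε ∎
  where
  open ℚ.≤-Reasoning
  rearrange : ∀ p q r s → (p ℚ.+ q) ℚ.- (r ℚ.+ s) ≡ (p ℚ.- r) ℚ.+ (q ℚ.- s)
  rearrange = solve 4 (λ p q r s → (p :+ q) :- (r :+ s) := (p :- r) :+ (q :- s)) ≡.refl
    where open +-*-Solver

≤-refl : ∀ {x} → x ≤ x
≤-refl {x} ε 0<ε = 0 , λ n _ → begin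
  seq x n          ≡⟨ ℚ.+-identityʳ (seq x n) ⟨
  seq x n ℚ.+ 0ℚ   ≤⟨ ℚ.+-monoʳ-≤ (seq x n) (ℚ.<⇒≤ 0<ε) ⟩
  seq x n ℚ.+ ε    ∎
  where open ℚ.≤-Reasoning

≤-trans : ∀ {x y z} → x ≤ y → y ≤ z → x ≤ z
≤-trans {x} {y} {z} x≤y y≤z ε 0<ε
  with x≤y (ε ℚ.* ½) (half-pos 0<ε) | y≤z (ε ℚ.* ½) (half-pos 0<ε)
... | M , x-below | N , y-below = M ℕ.⊔ N , λ n n≥ → begin
  seq x n                             ≤⟨ x-below n (⊔-boundˡ n≥) ⟩
  seq y n ℚ.+ ε ℚ.* ½                 ≤⟨ ℚ.+-monoˡ-≤ (ε ℚ.* ½) (y-below n (⊔-boundʳ n≥)) ⟩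
  (seq z n ℚ.+ ε ℚ.* ½) ℚ.+ ε ℚ.* ½   ≡⟨ ℚ.+-assoc (seq z n) _ _ ⟩
  seq z n ℚ.+ (ε ℚ.* ½ ℚ.+ ε ℚ.* ½)   ≡⟨ ≡.cong (seq z n ℚ.+_) (half+half ε) ⟩
  seq z n ℚ.+ ε                       ∎
  where open ℚ.≤-Reasoning

+-mono-≤ : ∀ {x y u v} → x ≤ y → u ≤ v → x + u ≤ y + v
+-mono-≤ {x} {y} {u} {v} x≤y u≤v ε 0<ε
  with x≤y (ε ℚ.* ½) (half-pos 0<ε) | u≤v (ε ℚ.* ½) (half-pos 0<ε)
... | M , x-below | N , u-below = M ℕ.⊔ N , λ n n≥ → begin
  seq x n ℚ.+ seq u n
    ≤⟨ ℚ.+-mono-≤ (x-below n (⊔-boundˡ n≥)) (u-below n (⊔-boundʳ n≥)) ⟩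
  (seq y n ℚ.+ ε ℚ.* ½) ℚ.+ (seq v n ℚ.+ ε ℚ.* ½)
    ≡⟨ rearrange (seq y n) (seq v n) (ε ℚ.* ½) ⟩
  (seq y n ℚ.+ seq v n) ℚ.+ (ε ℚ.* ½ ℚ.+ ε ℚ.* ½)
    ≡⟨ ≡.cong ((seq y n ℚ.+ seq v n) ℚ.+_) (half+half ε) ⟩
  (seq y n ℚ.+ seq v n) ℚ.+ ε ∎
  where
  open ℚ.≤-Reasoning
  rearrange : ∀ p q h → (p ℚ.+ h) ℚ.+ (q ℚ.+ h) ≡ (p ℚ.+ q) ℚ.+ (h ℚ.+ h)
  rearrange = solve 3 (λ p q h → (p :+ h) :+ (q :+ h) := (p :+ q) :+ (h :+ h)) ≡.refl
    where open +-*-Solver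

+-comm-≤ : ∀ x y → x + y ≤ y + x
+-comm-≤ x y ε 0<ε with ≤-refl {y + x} ε 0<ε
... | N , below = N , λ n n≥ →
  ≡.subst (ℚ._≤ (y + x) .seq n ℚ.+ ε) (ℚ.+-comm (seq y n) (seq x n)) (below n n≥)

ℝ-setoid : Setoid 0ℓ 0ℓ
ℝ-setoid = record
  { Carrier       = ℝ
  ; _≈_           = _≃_
  ; isEquivalence = record
    { refl  = λ {x} → ≤-refl {x} , ≤-refl {x}
    ; sym   = swap
    ; trans = λ {x} {y} {z} (x≤y , y≤x) (y≤z , z≤y) →
        ≤-trans {x} {y} {z} x≤y y≤z , ≤-trans {z} {y} {x} z≤y y≤x
    }
  }

HasCardinality : Setoid a b → ℕ → Set (a ⊔ b)
HasCardinality X k = Inverse (≡.setoid (Fin k)) X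

HasCardinality≥ : Setoid a b → ℕ → Set (a ⊔ b)
HasCardinality≥ X k = Injection (≡.setoid (Fin k)) X

IsFinite : Setoid a b → Set (a ⊔ b)
IsFinite X = ∃ λ k → HasCardinality X k

record SimpleGraph (V : Setoid a b) (e : Level) : Set (a ⊔ b ⊔ suc e) where
  open Setoid V using (_≈_) renaming (Carrier to Vertex)
  field
    Adj    : Rel Vertex e
    resp   : Adj Respects₂ _≈_
    sym    : Symmetric Adj
    irrefl : Irreflexive _≈_ Adj

module _ {V : Setoid a b} where
  open Setoid V using (_≈_; _≉_) renaming (Carrier to Vertex)

  thresholdGraph : Func V ℝ-setoid → ℝ → SimpleGraph V b
  thresholdGraph α S = record
    { Adj    = λ v w → v ≉ w × S ≤ to v + to w
    ; resp   =
        (λ {v} {w} {w′} w≈w′ (v≉w , S≤) →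
            (λ v≈w′ → v≉w (V.trans v≈w′ (V.sym w≈w′)))
          , ≤-trans {S} {to v + to w} {to v + to w′} S≤
              (+-mono-≤ {to v} {to v} {to w} {to w′} (≤-refl {to v}) (proj₁ (cong w≈w′))))
      , (λ {w} {v} {v′} v≈v′ (v≉w , S≤) →
            (λ v′≈w → v≉w (V.trans v≈v′ v′≈w))
          , ≤-trans {S} {to v + to w} {to v′ + to w} S≤
              (+-mono-≤ {to v} {to v′} {to w} {to w} (proj₁ (cong v≈v′)) (≤-refl {to w})))
    ; sym    = λ {v} {w} (v≉w , S≤) →
            (λ w≈v → v≉w (V.sym w≈v))
          , ≤-trans {S} {to v + to w} {to w + to v} S≤ (+-comm-≤ (to v) (to w))
    ; irrefl = λ v≈w (v≉w , _) → v≉w v≈w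
    }
    where
    open Func α
    module V = Setoid V

  open SimpleGraph

  IsThresholdGraph : SimpleGraph V e → Set (a ⊔ b ⊔ e)
  IsThresholdGraph H = ∃ λ α → ∃ λ S → ∀ v w → Adj H v w ⇔ Adj (thresholdGraph α S) v w

  -- Edges are pairs of distinct vertices, so that the empty intersection
  -- (d = 0) consists of all pairs v ≉ w.
  IsIntersectionOfThresholdGraphs : SimpleGraph V e → ℕ → Set (a ⊔ b ⊔ suc e)
  IsIntersectionOfThresholdGraphs {e} G d =
    ∃ λ (H : Fin d → SimpleGraph V e) →
      (∀ j → IsThresholdGraph (H j)) ×
      (∀ v w → v ≉ w → Adj G v w ⇔ (∀ j → Adj (H j) v w))

  -- dim_TH(G) = d.  A relation, since over an infinite vertex set no d need exist.
  HasThresholdDimension : SimpleGraph V e → ℕ → Set (a ⊔ b ⊔ suc e)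
  HasThresholdDimension G d =
    IsIntersectionOfThresholdGraphs G d ×
    (∀ d′ → IsIntersectionOfThresholdGraphs G d′ → d ℕ.≤ d′)

module _ (Q : CommutativeRing c ℓ) where
  open CommutativeRing Q
    renaming (_+_ to _+ᴿ_; trans to ≈-trans; sym to ≈-sym)

  IsZeroDivisor : Pred Carrier (c ⊔ ℓ)
  IsZeroDivisor r = ∃ λ s → s ≉ 0# × r * s ≈ 0#

  -- Z(Q) \ {0}, with the equality of Q: the witnesses s are irrelevant
  nonzeroZeroDivisors : Setoid (c ⊔ ℓ) ℓ
  nonzeroZeroDivisors = record
    { Carrier       = ∃ λ r → IsZeroDivisor r × r ≉ 0#
    ; _≈_           = λ r s → proj₁ r ≈ proj₁ s
    ; isEquivalence = record { refl = refl ; sym = ≈-sym ; trans = ≈-trans }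
    }

  zeroDivisorGraph : SimpleGraph nonzeroZeroDivisors ℓ
  zeroDivisorGraph = record
    { Adj    = λ (r , _) (s , _) → r ≉ s × r * s ≈ 0#
    ; resp   =
        (λ s≈s′ (r≉s , rs≈0) →
            (λ r≈s′ → r≉s (≈-trans r≈s′ (≈-sym s≈s′)))
          , ≈-trans (*-congˡ (≈-sym s≈s′)) rs≈0)
      , (λ r≈r′ (r≉s , rs≈0) →
            (λ r′≈s → r≉s (≈-trans r≈r′ r′≈s))
          , ≈-trans (*-congʳ (≈-sym r≈r′)) rs≈0)
    ; sym    = λ (r≉s , rs≈0) →
            (λ s≈r → r≉s (≈-sym s≈r))
          , ≈-trans (*-comm _ _) rs≈0
    ; irrefl = λ r≈s (r≉s , _) → r≉s r≈s
    }

module RingTheory (R : CommutativeRing c ℓ) where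
  open CommutativeRing R
    renaming (_+_ to _+ᴿ_; _-_ to _-ᴿ_; trans to ≈-trans; sym to ≈-sym)

  open RawSemiringDefinitions (Semiring.rawSemiring semiring) public
    using (_∣_; Prime; product; _^_)
  open import Algebra.Definitions.RawMagma *-rawMagma public
    using (_∦_)
  open import Algebra.Definitions.RawMagma *-rawMagma using (_,_)

  IsUnit : Pred Carrier (c ⊔ ℓ)
  IsUnit u = u ∣ 1#

  record Ideal : Set (suc (c ⊔ ℓ)) where
    field
      Member   : Pred Carrier (c ⊔ ℓ)
      resp     : Member Respects _≈_
      0∈       : 0# ∈ Member
      +-closed : ∀ {x y} → x ∈ Member → y ∈ Member → x +ᴿ y ∈ Member
      *-closed : ∀ r {x} → x ∈ Member → r * x ∈ Member

  open Ideal

  IsProper : Ideal → Set (c ⊔ ℓ)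
  IsProper I = ¬ (∀ x → x ∈ Member I)

  record IsPrimeIdeal (I : Ideal) : Set (c ⊔ ℓ) where
    field
      proper : IsProper I
      split  : ∀ {x y} → x * y ∈ Member I → x ∈ Member I ⊎ y ∈ Member I

  open import Algebra.Properties.Ring ring
    using (-1*x≈-x; -‿+-comm; ⁻¹-anti-homo-//; //-rightDividesˡ; x[y-z]≈xy-xz; [y-z]x≈yx-zx)
  open import Algebra.Properties.CommutativeSemigroup +-commutativeSemigroup using (interchange)

  ⟨_⟩ : Carrier → Ideal
  ⟨ g ⟩ = record
    { Member   = g ∣_
    ; resp     = λ x≈y (q , qg≈x) → q , ≈-trans qg≈x x≈y
    ; 0∈       = 0# , zeroˡ g
    ; +-closed = λ (q , qg≈x) (r , rg≈y) →
        (q +ᴿ r) , ≈-trans (distribʳ g q r) (+-cong qg≈x rg≈y)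
    ; *-closed = λ r (q , qg≈x) →
        (r * q) , ≈-trans (*-assoc r q g) (*-congˡ qg≈x)
    }

  Quotient : Ideal → CommutativeRing c (c ⊔ ℓ)
  Quotient I = record
    { Carrier           = Carrier
    ; _≈_               = _~_
    ; _+_               = _+ᴿ_
    ; _*_               = _*_
    ; -_                = -_
    ; 0#                = 0#
    ; 1#                = 1#
    ; isCommutativeRing = record
      { isRing = record
        { +-isAbelianGroup = record
          { isGroup = record
            { isMonoid = record
              { isSemigroup = record
                { isMagma = record
                  { isEquivalence = record
                    { refl  = ≈⇒~ refl
                    ; sym   = λ {x} {y} x~y →
                        resp I (⁻¹-anti-homo-// x y) (neg-closed x~y)
                    ; trans = ~-trans
                    }
                  ; ∙-cong = λ {x} {y} {u} {v} x~y u~v →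
                      resp I (≈-trans (interchange x (- y) u (- v)) (+-congˡ (-‿+-comm y v)))
                             (+-closed I x~y u~v)
                  }
                ; assoc = λ x y z → ≈⇒~ (+-assoc x y z)
                }
              ; identity = (λ x → ≈⇒~ (+-identityˡ x)) , (λ x → ≈⇒~ (+-identityʳ x))
              }
            ; inverse = (λ x → ≈⇒~ (-‿inverseˡ x)) , (λ x → ≈⇒~ (-‿inverseʳ x))
            ; ⁻¹-cong = λ {x} {y} x~y →
                resp I (≈-sym (-‿+-comm x (- y))) (neg-closed x~y)
            }
          ; comm = λ x y → ≈⇒~ (+-comm x y)
          }
        ; *-cong = λ {x} {y} {u} {v} x~y u~v → ~-trans
            (resp I (≈-trans (*-comm u (x -ᴿ y)) ([y-z]x≈yx-zx u x y)) (*-closed I u x~y))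
            (resp I (x[y-z]≈xy-xz y u v) (*-closed I y u~v))
        ; *-assoc = λ x y z → ≈⇒~ (*-assoc x y z)
        ; *-identity = (λ x → ≈⇒~ (*-identityˡ x)) , (λ x → ≈⇒~ (*-identityʳ x))
        ; distrib = (λ x y z → ≈⇒~ (distribˡ x y z)) , (λ x y z → ≈⇒~ (distribʳ x y z))
        }
      ; *-comm = λ x y → ≈⇒~ (*-comm x y)
      }
    }
    where
    _~_ : Rel Carrier (c ⊔ ℓ)
    x ~ y = x -ᴿ y ∈ Member I

    ≈⇒~ : ∀ {x y} → x ≈ y → x ~ y
    ≈⇒~ {x} {y} x≈y = resp I (≈-sym (≈-trans (+-congʳ x≈y) (-‿inverseʳ y))) (0∈ I)

    ~-trans : ∀ {x y z} → x ~ y → y ~ z → x ~ z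
    ~-trans {x} {y} {z} x~y y~z = resp I
      (≈-trans (≈-sym (+-assoc (x -ᴿ y) y (- z))) (+-congʳ (//-rightDividesˡ y x)))
      (+-closed I x~y y~z)

    neg-closed : ∀ {x} → x ∈ Member I → - x ∈ Member I
    neg-closed {x} x∈I =
      resp I (-1*x≈-x x) (*-closed I (- 1#) x∈I)

  -- Ideals are arbitrary subsets, as in classical algebra.  Applied to the
  -- ideals { x | x ≈ 0# or P } the last field yields excluded middle at
  -- level c ⊔ ℓ, so that every instance lives in classical mathematics.
  record IsPrincipalIdealDomain : Set (suc (c ⊔ ℓ)) where
    field
      1≉0       : 1# ≉ 0#
      noZeroDiv : ∀ {x y} → x * y ≈ 0# → x ≈ 0# ⊎ y ≈ 0#
      principal : (I : Ideal) → ∃ λ g → Member I ≐ Member ⟨ g ⟩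

-- Let eᵢ = g / pᵢ^mᵢ.  Modulo g, r s = 0 iff vᵢ(r) + vᵢ(s) ≥ mᵢ for all i, so the truncated
-- valuations vᵢ exhibit Γ as an intersection of n threshold graphs.  When g is squarefree and
-- R/p₀ has two elements, two distinct vertices whose supports { i | pᵢ ∤ r } meet only in 0 are
-- not both supported in {0}; hence the threshold graphs of the other primes can absorb the
-- non-edges of p₀, and n - 1 suffice.
--
-- For the lower bounds, take non-adjacent pairs (aᵢ, bᵢ) with aᵢ adjacent to bⱼ for i ≠ j.
-- A threshold graph has no alternating 4-cycle, so no threshold graph containing Γ omits two
-- of these pairs, and there are at most dim Γ of them.  Such pairs are (eᵢ, c eᵢ), if some c is
-- neither 0 nor 1 modulo pᵢ; (eᵢ, eᵢ + e₀) for i ≠ 0; and, if m₀ ≥ 2, (p₀ e₀, e₀) together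
-- with (eᵢ, eᵢ + g / p₀) for i ≠ 0.

module Submission where

open import Defs
open import Algebra.Bundles using (CommutativeRing)
open import Data.Fin.Base using (Fin)
open import Data.Nat.Base using (ℕ; _≥_; _∸_)
open import Data.Product using (∃; ∃!; _×_)
open import Level using (Level)
open import Relation.Binary.PropositionalEquality.Core using (_≡_; _≢_)
open import Relation.Nullary.Negation.Core using (¬_)

import Algebra.Definitions.RawMagma
import Algebra.Properties.CommutativeMonoid.Sum
import Algebra.Properties.CommutativeSemigroup
import Algebra.Properties.CommutativeSemigroup.Divisibility
import Algebra.Properties.Monoid.Mult
import Algebra.Properties.Ring
import Algebra.Properties.Semiring.Divisibility
import Algebra.Properties.Semiring.Exp
open import Axiom.ExcludedMiddle using (ExcludedMiddle)
open import Data.Bool.Base using (Bool; true; false)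
open import Data.Fin.Base using (zero; suc; punchIn; punchOut)
import Data.Fin.Properties as Fin
open import Data.Nat.Base as ℕ using (zero; suc)
import Data.Nat.Properties as ℕ
open import Data.Product using (_,_; proj₁; proj₂)
open import Data.Rational.Base as ℚ using (ℚ; 0ℚ; 1ℚ; ½)
import Data.Rational.Properties as ℚ
open import Data.Rational.Solver using (module +-*-Solver)
open import Data.Sum.Base using (_⊎_; inj₁; inj₂; [_,_]′)
open import Function.Base using (_∘_)
open import Function.Bundles using (Func; Injection; Inverse; _⇔_; mk⇔; Equivalence)
open import Level using (_⊔_)
open import Relation.Binary.Bundles using (Setoid)
open import Relation.Binary.PropositionalEquality as ≡ using ()
open import Relation.Nullary.Decidable using (Dec; yes; no; does; does-⇔; decidable-stable)
open import Relation.Nullary.Negation.Core using (contradiction)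

open ℝ
open Algebra.Properties.Monoid.Mult ℚ.+-0-monoid
  using () renaming (_×_ to _×ℚ_; ×-homo-+ to ×ℚ-homo-+)

private
  variable
    a b c e ℓ : Level
    k : ℕ

-- Inequalities between rational and real numbers.

constant : ℚ → ℝ
constant q .seq    _ = q
constant q .cauchy ε 0<ε = 0 , λ _ _ _ _ →
  ≡.subst (ℚ._< ε) (≡.sym (≡.cong ℚ.∣_∣ (ℚ.+-inverseʳ q))) 0<ε

constant-mono-≤ : ∀ {p q} → p ℚ.≤ q → constant p ≤ constant q
constant-mono-≤ {p} {q} p≤q ε 0<ε = 0 , λ _ _ →
  ≡.subst (ℚ._≤ q ℚ.+ ε) (ℚ.+-identityʳ p) (ℚ.+-mono-≤ p≤q (ℚ.<⇒≤ 0<ε))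

constant-cancel-≤ : ∀ {p q} → constant p ≤ constant q → p ℚ.≤ q
constant-cancel-≤ {p} {q} p≤q with p ℚ.≤? q
... | yes p≤q′ = p≤q′
... | no  p≰q  with ℚ.<-dense (ℚ.≰⇒> p≰q)
-- With `m` strictly between `q` and `p`, the tolerance `m - q` forces `p ≤ m`, contradicting
-- `m < p`.
...   | m , q<m , m<p with p≤q (m ℚ.- q)
        (≡.subst (ℚ._< m ℚ.- q) (ℚ.+-inverseʳ q) (ℚ.+-monoˡ-< (ℚ.- q) q<m))
...     | N , below = contradiction
  (ℚ.<-≤-trans m<p (≡.subst (p ℚ.≤_) (q+[m-q]≡m q m) (below N ℕ.≤-refl))) (ℚ.<-irrefl ≡.refl)
  where
  q+[m-q]≡m : ∀ q m → q ℚ.+ (m ℚ.- q) ≡ m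
  q+[m-q]≡m = solve 2 (λ q m → q :+ (m :- q) := m) ≡.refl
    where open +-*-Solver

∣p-q∣<δ⇒p≤q+δ : ∀ {p q δ} → ℚ.∣ p ℚ.- q ∣ ℚ.< δ → p ℚ.≤ q ℚ.+ δ
∣p-q∣<δ⇒p≤q+δ {p} {q} {δ} close = begin
  p                           ≡⟨ p≡q+[p-q] p q ⟩
  q ℚ.+ (p ℚ.- q)             ≤⟨ ℚ.+-monoʳ-≤ q (p≤∣p∣ (p ℚ.- q)) ⟩
  q ℚ.+ ℚ.∣ p ℚ.- q ∣         ≤⟨ ℚ.+-monoʳ-≤ q (ℚ.<⇒≤ close) ⟩
  q ℚ.+ δ                     ∎
  where
  open ℚ.≤-Reasoning
  p≡q+[p-q] : ∀ p q → p ≡ q ℚ.+ (p ℚ.- q)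
  p≡q+[p-q] = solve 2 (λ p q → p := q :+ (p :- q)) ≡.refl
    where open +-*-Solver
  p≤∣p∣ : ∀ p → p ℚ.≤ ℚ.∣ p ∣
  p≤∣p∣ p with ℚ.≤-total 0ℚ p
  ... | inj₁ 0≤p = ℚ.≤-reflexive (≡.sym (ℚ.0≤p⇒∣p∣≡p 0≤p))
  ... | inj₂ p≤0 = ℚ.≤-trans p≤0 (ℚ.0≤∣p∣ p)

-- Approximations within ε/4 at a common index either witness y ≤ x + ε eventually, or
-- separate x from y and so show x ≤ y; no excluded middle is needed.
≰⇒≥ : ∀ x y → ¬ (x ≤ y) → y ≤ x
≰⇒≥ x y x≰y ε 0<ε = N ,
  [ near⇒≤ , (λ far → contradiction (far⇒≤ far) x≰y) ]′
    (ℚ.≤-total (seq y N) (seq x N ℚ.+ (δ ℚ.+ δ)))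
  where
  open ℚ.≤-Reasoning
  δ = ε ℚ.* ½ ℚ.* ½
  0<δ : 0ℚ ℚ.< δ
  0<δ = ℚ.*-monoˡ-<-pos ½ (ℚ.*-monoˡ-<-pos ½ 0<ε)
  Nx = proj₁ (cauchy x δ 0<δ)
  Ny = proj₁ (cauchy y δ 0<δ)
  N  = Nx ℕ.⊔ Ny
  N≥Nx = ℕ.m≤m⊔n Nx Ny
  N≥Ny = ℕ.m≤n⊔m Nx Ny

  x-close : ∀ m n → N ℕ.≤ m → N ℕ.≤ n → seq x m ℚ.≤ seq x n ℚ.+ δ
  x-close m n N≤m N≤n = ∣p-q∣<δ⇒p≤q+δ
    (proj₂ (cauchy x δ 0<δ) m n (ℕ.≤-trans N≥Nx N≤m) (ℕ.≤-trans N≥Nx N≤n))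

  y-close : ∀ m n → N ℕ.≤ m → N ℕ.≤ n → seq y m ℚ.≤ seq y n ℚ.+ δ
  y-close m n N≤m N≤n = ∣p-q∣<δ⇒p≤q+δ
    (proj₂ (cauchy y δ 0<δ) m n (ℕ.≤-trans N≥Ny N≤m) (ℕ.≤-trans N≥Ny N≤n))

  half+half : ∀ p → p ℚ.* ½ ℚ.+ p ℚ.* ½ ≡ p
  half+half p = ≡.trans (≡.sym (ℚ.*-distribˡ-+ p ½ ½)) (ℚ.*-identityʳ p)

  collect : ∀ p d → ((p ℚ.+ d) ℚ.+ (d ℚ.+ d)) ℚ.+ d ≡ p ℚ.+ ((d ℚ.+ d) ℚ.+ (d ℚ.+ d))
  collect = solve 2 (λ p d → ((p :+ d) :+ (d :+ d)) :+ d := p :+ ((d :+ d) :+ (d :+ d))) ≡.refl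
    where open +-*-Solver

  regroup : ∀ p d → p ℚ.+ d ≡ (p ℚ.+ (d ℚ.+ d)) ℚ.- d
  regroup = solve 2 (λ p d → p :+ d := (p :+ (d :+ d)) :- d) ≡.refl
    where open +-*-Solver

  cancel : ∀ p d → (p ℚ.+ d) ℚ.- d ≡ p
  cancel = solve 2 (λ p d → (p :+ d) :- d := p) ≡.refl
    where open +-*-Solver

  near⇒≤ : seq y N ℚ.≤ seq x N ℚ.+ (δ ℚ.+ δ) → ∀ n → N ℕ.≤ n → seq y n ℚ.≤ seq x n ℚ.+ ε
  near⇒≤ near n N≤n = begin
    seq y n
      ≤⟨ y-close n N N≤n ℕ.≤-refl ⟩
    seq y N ℚ.+ δ
      ≤⟨ ℚ.+-monoˡ-≤ δ near ⟩
    (seq x N ℚ.+ (δ ℚ.+ δ)) ℚ.+ δ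
      ≤⟨ ℚ.+-monoˡ-≤ δ (ℚ.+-monoˡ-≤ (δ ℚ.+ δ) (x-close N n ℕ.≤-refl N≤n)) ⟩
    ((seq x n ℚ.+ δ) ℚ.+ (δ ℚ.+ δ)) ℚ.+ δ
      ≡⟨ collect (seq x n) δ ⟩
    seq x n ℚ.+ ((δ ℚ.+ δ) ℚ.+ (δ ℚ.+ δ))
      ≡⟨ ≡.cong (λ h → seq x n ℚ.+ (h ℚ.+ h)) (half+half (ε ℚ.* ½)) ⟩
    seq x n ℚ.+ (ε ℚ.* ½ ℚ.+ ε ℚ.* ½)
      ≡⟨ ≡.cong (seq x n ℚ.+_) (half+half ε) ⟩
    seq x n ℚ.+ ε ∎

  far⇒≤ : seq x N ℚ.+ (δ ℚ.+ δ) ℚ.≤ seq y N → x ≤ y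
  far⇒≤ far ε′ 0<ε′ = N , λ n N≤n → begin
    seq x n                          ≤⟨ x-close n N N≤n ℕ.≤-refl ⟩
    seq x N ℚ.+ δ                    ≡⟨ regroup (seq x N) δ ⟩
    (seq x N ℚ.+ (δ ℚ.+ δ)) ℚ.- δ    ≤⟨ ℚ.+-monoˡ-≤ (ℚ.- δ) far ⟩
    seq y N ℚ.- δ                    ≤⟨ ℚ.+-monoˡ-≤ (ℚ.- δ) (y-close N n ℕ.≤-refl N≤n) ⟩
    (seq y n ℚ.+ δ) ℚ.- δ            ≡⟨ cancel (seq y n) δ ⟩
    seq y n                          ≡⟨ ℚ.+-identityʳ (seq y n) ⟨
    seq y n ℚ.+ 0ℚ                   ≤⟨ ℚ.+-monoʳ-≤ (seq y n) (ℚ.<⇒≤ 0<ε′) ⟩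
    seq y n ℚ.+ ε′                   ∎

-- By totality `w + z ≤ s`, so `s + (w + z) ≤ s + s ≤ (w + x) + (y + z)`; cancelling `w + z` leaves
-- the claim.
exchange-≤ : ∀ s w x y z → s ≤ w + x → s ≤ y + z → ¬ (s ≤ w + z) → s ≤ y + x
exchange-≤ s w x y z s≤w+x s≤y+z s≰w+z ε 0<ε = proj₁ total , λ n N≤n → begin
  seq s n
    ≡⟨ cancel (seq s n) (seq w n ℚ.+ seq z n) ⟩
  (seq s n ℚ.+ (seq w n ℚ.+ seq z n)) ℚ.- (seq w n ℚ.+ seq z n)
    ≤⟨ ℚ.+-monoˡ-≤ (ℚ.- (seq w n ℚ.+ seq z n)) (proj₂ total n N≤n) ⟩
  (((seq w n ℚ.+ seq x n) ℚ.+ (seq y n ℚ.+ seq z n)) ℚ.+ ε) ℚ.- (seq w n ℚ.+ seq z n)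
    ≡⟨ regroup (seq w n) (seq x n) (seq y n) (seq z n) ε ⟩
  (seq y n ℚ.+ seq x n) ℚ.+ ε ∎
  where
  open ℚ.≤-Reasoning
  total : ∃ λ N → ∀ n → N ℕ.≤ n → seq (s + (w + z)) n ℚ.≤ seq ((w + x) + (y + z)) n ℚ.+ ε
  total = ≤-trans {s + (w + z)} {s + s} {(w + x) + (y + z)}
    (+-mono-≤ {s} {s} {w + z} {s} (≤-refl {s}) (≰⇒≥ s (w + z) s≰w+z))
    (+-mono-≤ {s} {w + x} {s} {y + z} s≤w+x s≤y+z) ε 0<ε
  cancel : ∀ p q → p ≡ (p ℚ.+ q) ℚ.- q
  cancel = solve 2 (λ p q → p := (p :+ q) :- q) ≡.refl
    where open +-*-Solver
  regroup : ∀ w x y z ε → (((w ℚ.+ x) ℚ.+ (y ℚ.+ z)) ℚ.+ ε) ℚ.- (w ℚ.+ z) ≡ (y ℚ.+ x) ℚ.+ ε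
  regroup = solve 5
    (λ w x y z ε → (((w :+ x) :+ (y :+ z)) :+ ε) :- (w :+ z) := (y :+ x) :+ ε) ≡.refl
    where open +-*-Solver

×1ℚ-mono-≤ : ∀ {m n} → m ℕ.≤ n → m ×ℚ 1ℚ ℚ.≤ n ×ℚ 1ℚ
×1ℚ-mono-≤ {n = zero}  ℕ.z≤n       = ℚ.≤-refl
×1ℚ-mono-≤ {n = suc n} ℕ.z≤n       = ≡.subst (ℚ._≤ suc n ×ℚ 1ℚ) (ℚ.+-identityʳ 0ℚ)
  (ℚ.+-mono-≤ (ℚ.nonNegative⁻¹ 1ℚ) (×1ℚ-mono-≤ {n = n} ℕ.z≤n))
×1ℚ-mono-≤             (ℕ.s≤s m≤n) = ℚ.+-monoʳ-≤ 1ℚ (×1ℚ-mono-≤ m≤n)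

×1ℚ-cancel-≤ : ∀ m n → m ×ℚ 1ℚ ℚ.≤ n ×ℚ 1ℚ → m ℕ.≤ n
×1ℚ-cancel-≤ m n m≤n with m ℕ.≤? n
... | yes m≤n′ = m≤n′
... | no  m≰n  = contradiction
  (ℚ.<-≤-trans n<1+n (ℚ.≤-trans (×1ℚ-mono-≤ (ℕ.≰⇒> m≰n)) m≤n)) (ℚ.<-irrefl ≡.refl)
  where
  n<1+n : n ×ℚ 1ℚ ℚ.< 1ℚ ℚ.+ n ×ℚ 1ℚ
  n<1+n = ≡.subst (ℚ._< 1ℚ ℚ.+ n ×ℚ 1ℚ) (ℚ.+-identityˡ (n ×ℚ 1ℚ))
    (ℚ.+-monoˡ-< (n ×ℚ 1ℚ) (ℚ.positive⁻¹ 1ℚ))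

-- Threshold graphs and lower bounds from crossing pairs.

module _ {V : Setoid a b} where
  open Setoid V using (_≈_; _≉_) renaming (Carrier to Vertex)
  open SimpleGraph
  open Equivalence using (to; from)

  -- All upper bounds below come from natural weights. The map `n ↦ n ×ℚ 1ℚ` is additive and both
  -- preserves and reflects the order, so the real threshold conditions become the natural ones.
  isIntersectionOfThresholdGraphs :
    (G : SimpleGraph V b) {d : ℕ} (α : Fin d → Vertex → ℕ) (S : Fin d → ℕ) →
    (∀ j {v w} → v ≈ w → α j v ≡ α j w) →
    (∀ v w → v ≉ w → Adj G v w ⇔ (∀ j → S j ℕ.≤ α j v ℕ.+ α j w)) →
    IsIntersectionOfThresholdGraphs G d
  isIntersectionOfThresholdGraphs G {d} α S α-cong G⇔α =
      (λ j → thresholdGraph (αℝ j) (threshold j))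
    , (λ j → αℝ j , threshold j , λ _ _ → mk⇔ (λ adj → adj) (λ adj → adj))
    , (λ v w v≉w → mk⇔
        (λ adj j → v≉w , constant-mono-≤ (≡.subst (S j ×ℚ 1ℚ ℚ.≤_)
          (×ℚ-homo-+ 1ℚ (α j v) (α j w)) (×1ℚ-mono-≤ (to (G⇔α v w v≉w) adj j))))
        (λ adj → from (G⇔α v w v≉w) λ j → ×1ℚ-cancel-≤ _ _
          (≡.subst (S j ×ℚ 1ℚ ℚ.≤_) (≡.sym (×ℚ-homo-+ 1ℚ (α j v) (α j w)))
            (constant-cancel-≤ (proj₂ (adj j))))))
    where
    threshold : Fin d → ℝ
    threshold j = constant (S j ×ℚ 1ℚ)
    αℝ : Fin d → Func V ℝ-setoid
    αℝ j = record
      { to   = λ v → constant (α j v ×ℚ 1ℚ)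
      ; cong = λ {v} {w} v≈w →
          ≡.subst (λ n → constant (α j v ×ℚ 1ℚ) ≃ constant (n ×ℚ 1ℚ)) (α-cong j v≈w)
            (≤-refl {constant (α j v ×ℚ 1ℚ)} , ≤-refl {constant (α j v ×ℚ 1ℚ)})
      }

  -- The edges `v w′`, `v′ w` and the pairs `v w`, `v′ w′` have the same total weight, at least
  -- `S + S`. If `v w` falls short of `S`, then `v′ w′` makes up for it.
  noAlternating4Cycle : (H : SimpleGraph V e) → IsThresholdGraph H → ∀ {v v′ w w′} →
    v ≉ w → v′ ≉ w′ → Adj H v w′ → Adj H v′ w → ¬ Adj H v w → Adj H v′ w′
  noAlternating4Cycle H (α , S , H⇔) {v} {v′} {w} {w′} v≉w v′≉w′ vw′ v′w ¬vw =
    from (H⇔ v′ w′) (v′≉w′ , exchange-≤ S (α′ v) (α′ w′) (α′ v′) (α′ w)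
      (proj₂ (to (H⇔ v w′) vw′)) (proj₂ (to (H⇔ v′ w) v′w))
      (λ S≤ → ¬vw (from (H⇔ v w) (v≉w , S≤))))
    where α′ = Func.to α

  -- Each non-edge `v i`, `w i` is omitted by some `H j`, found by excluded middle. If `i ≢ i′`
  -- shared this `j`, the two cross edges would form an alternating 4-cycle in `H j`; so the choice
  -- of `j` is injective.
  crossing⇒≤ : ExcludedMiddle e → (G : SimpleGraph V e) (v w : Fin k → Vertex) →
    (∀ i → v i ≉ w i) → (∀ i → ¬ Adj G (v i) (w i)) → (∀ i j → i ≢ j → Adj G (v i) (w j)) →
    ∀ d → IsIntersectionOfThresholdGraphs G d → k ℕ.≤ d
  crossing⇒≤ {e} {k} em G v w v≉w ¬vw crossing d (H , threshold , G⇔) =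
    Fin.injective⇒≤ separator-injective
    where
    separated : ∀ i → ∃ λ j → ¬ Adj (H j) (v i) (w i)
    separated i = Fin.¬∀⟶∃¬ d _ (λ _ → em) (¬vw i ∘ from (G⇔ (v i) (w i) (v≉w i)))

    separator : Fin k → Fin d
    separator = proj₁ ∘ separated

    cross : ∀ j {i i′} → i ≢ i′ → Adj (H j) (v i) (w i′)
    cross j {i} {i′} i≢i′ = to (G⇔ (v i) (w i′) (λ v≈w → irrefl G v≈w (crossing i i′ i≢i′)))
      (crossing i i′ i≢i′) j

    separator-injective : ∀ {i i′} → separator i ≡ separator i′ → i ≡ i′
    separator-injective {i} {i′} eq = decidable-stable (i Fin.≟ i′) λ i≢i′ →
      proj₂ (separated i′) (≡.subst (λ j → Adj (H j) (v i′) (w i′)) eq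
        (noAlternating4Cycle (H (separator i)) (threshold _) (v≉w i) (v≉w i′)
          (cross _ i≢i′) (cross _ (i≢i′ ∘ ≡.sym)) (proj₂ (separated i))))

module _ (Q : CommutativeRing c ℓ) where
  open CommutativeRing Q renaming (_+_ to _+ᴿ_; _-_ to _-ᴿ_)

  -- Since `a i * b i ≉ 0#`, neither factor is zero, so zero divisors here are vertices.
  zeroDivisorCrossing⇒≤ : ExcludedMiddle ℓ → (a b : Fin k → Carrier) →
    (∀ i → IsZeroDivisor Q (a i)) → (∀ i → IsZeroDivisor Q (b i)) →
    (∀ i → a i ≉ b i) → (∀ i → a i * b i ≉ 0#) →
    (∀ i j → i ≢ j → a i ≉ b j) → (∀ i j → i ≢ j → a i * b j ≈ 0#) →
    ∀ d → IsIntersectionOfThresholdGraphs (zeroDivisorGraph Q) d → k ℕ.≤ d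
  zeroDivisorCrossing⇒≤ em a b a-zd b-zd a≉b ab≉0 a≉b′ ab′≈0 =
    crossing⇒≤ em (zeroDivisorGraph Q)
      (λ i → a i , a-zd i , λ a≈0 → ab≉0 i (trans (*-congʳ a≈0) (zeroˡ (b i))))
      (λ i → b i , b-zd i , λ b≈0 → ab≉0 i (trans (*-congˡ b≈0) (zeroʳ (a i))))
      a≉b (λ i (_ , ab≈0) → ab≉0 i ab≈0) (λ i j i≢j → a≉b′ i j i≢j , ab′≈0 i j i≢j)

another : k ≥ 1 → (i : Fin (suc k)) → ∃ λ j → i ≢ j
another (ℕ.s≤s _) zero    = suc zero , λ ()
another (ℕ.s≤s _) (suc _) = zero , λ ()

oneOfTwo : k ≡ 1 → {i j : Fin (suc k)} → i ≢ j → ∀ l → i ≡ l ⊎ j ≡ l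
oneOfTwo ≡.refl {zero}     {zero}     i≢j _          = contradiction ≡.refl i≢j
oneOfTwo ≡.refl {zero}     {suc zero} _   zero       = inj₁ ≡.refl
oneOfTwo ≡.refl {zero}     {suc zero} _   (suc zero) = inj₂ ≡.refl
oneOfTwo ≡.refl {suc zero} {zero}     _   zero       = inj₂ ≡.refl
oneOfTwo ≡.refl {suc zero} {zero}     _   (suc zero) = inj₁ ≡.refl
oneOfTwo ≡.refl {suc zero} {suc zero} i≢j _          = contradiction ≡.refl i≢j

-- Divisibility and congruences in a commutative ring.

module Divisibility (R : CommutativeRing c ℓ) where
  open CommutativeRing R hiding (zero) renaming (_+_ to _+ᴿ_; _-_ to _-ᴿ_)
  open RingTheory R
  open Algebra.Properties.CommutativeSemigroup.Divisibility *-commutativeSemigroup public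
    using ( x∣xy; x∣ʳyx; x∣ʳy⇒x∣ʳzy; x∣ʳy⇒xz∣ʳyz; ∙-cong-∣
          ; ∣ʳ-trans; ∣ʳ-respʳ-≈; ∣ʳ-respˡ-≈)
  open Algebra.Properties.Semiring.Divisibility semiring public using (1∣_; ∣ʳ-refl)
  open Algebra.Properties.Semiring.Exp semiring public using (^-homo-*)
  open Algebra.Properties.Ring ring using (-0#≈0#)

  x∣y⇒x∣yz : ∀ {x y} z → x ∣ y → x ∣ y * z
  x∣y⇒x∣yz {x} {y} z x∣y = ∣ʳ-trans x∣y (x∣xy y z)

  infix 4 _≈_[mod_]
  _≈_[mod_] : Carrier → Carrier → Carrier → Set _
  x ≈ y [mod d ] = CommutativeRing._≈_ (Quotient ⟨ d ⟩) x y

  module Mod (d : Carrier) = CommutativeRing (Quotient ⟨ d ⟩)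

  x-0≈x : ∀ x → x -ᴿ 0# ≈ x
  x-0≈x x = trans (+-congˡ -0#≈0#) (+-identityʳ x)

  ∣⇒≈0 : ∀ {d x} → d ∣ x → x ≈ 0# [mod d ]
  ∣⇒≈0 {x = x} = ∣ʳ-respʳ-≈ (sym (x-0≈x x))

  ≈0⇒∣ : ∀ {d x} → x ≈ 0# [mod d ] → d ∣ x
  ≈0⇒∣ {x = x} = ∣ʳ-respʳ-≈ (x-0≈x x)

  ∣-resp-mod : ∀ {d x y} → x ≈ y [mod d ] → d ∣ x → d ∣ y
  ∣-resp-mod {d} x≈y d∣x = ≈0⇒∣ (Mod.trans d (Mod.sym d x≈y) (∣⇒≈0 d∣x))

  ∣x+y∧∣y⇒∣x : ∀ {d x y} → d ∣ x +ᴿ y → d ∣ y → d ∣ x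
  ∣x+y∧∣y⇒∣x {d} {x} {y} d∣x+y d∣y = ∣-resp-mod
    (Mod.trans d (Mod.+-congˡ d {x} (∣⇒≈0 d∣y)) (Mod.+-identityʳ d x)) d∣x+y

  ∣x∧∣y⇒∣x+y : ∀ {d x y} → d ∣ x → d ∣ y → d ∣ x +ᴿ y
  ∣x∧∣y⇒∣x+y {d} = Ideal.+-closed ⟨ d ⟩

  x≈x+y⇒∣y : ∀ {d x y} → x ≈ x +ᴿ y [mod d ] → d ∣ y
  x≈x+y⇒∣y {d} {x} {y} x≈x+y = ≈0⇒∣ (+-cancelˡ x y 0#
    (Mod.trans d (Mod.sym d x≈x+y) (Mod.sym d (Mod.+-identityʳ d x))))
    where open Algebra.Properties.Ring (Mod.ring d) using (+-cancelˡ)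

  x^m∣x^n : ∀ x {m n} → m ℕ.≤ n → x ^ m ∣ x ^ n
  x^m∣x^n x {m} {n} m≤n = ∣ʳ-respʳ-≈
    (trans (sym (^-homo-* x m (n ∸ m))) (reflexive (≡.cong (x ^_) (ℕ.m+[n∸m]≡n m≤n))))
    (x∣xy (x ^ m) (x ^ (n ∸ m)))

  x∣x^n : ∀ x {n} → n ≥ 1 → x ∣ x ^ n
  x∣x^n x {suc n} _ = x∣xy x (x ^ n)

  fᵢ∣product : ∀ {n} (f : Fin n → Carrier) i → f i ∣ product f
  fᵢ∣product f zero    = x∣xy (f zero) (product (f ∘ suc))
  fᵢ∣product f (suc i) = x∣ʳy⇒x∣ʳzy (f zero) (fᵢ∣product (f ∘ suc) i)

  prime∤power : ∀ {p x} → Prime p → ¬ p ∣ x → ∀ n → ¬ p ∣ x ^ n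
  prime∤power p-prime p∤x zero    = Prime.p∤1 p-prime
  prime∤power p-prime p∤x (suc n) p∣ with Prime.split-∣ p-prime p∣
  ... | inj₁ p∣x  = p∤x p∣x
  ... | inj₂ p∣xⁿ = prime∤power p-prime p∤x n p∣xⁿ

  prime∤product : ∀ {n p} → Prime p → (f : Fin n → Carrier) → (∀ i → ¬ p ∣ f i) → ¬ p ∣ product f
  prime∤product {zero}  p-prime f p∤f = Prime.p∤1 p-prime
  prime∤product {suc n} p-prime f p∤f p∣ with Prime.split-∣ p-prime p∣
  ... | inj₁ p∣f₀ = p∤f zero p∣f₀
  ... | inj₂ p∣∏  = prime∤product p-prime (f ∘ suc) (p∤f ∘ suc) p∣∏

-- The vertex weights of the threshold graph whose non-edges are the pairs that both have p
-- in their support, and the pairs that both have q in their support with p in at least one;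
-- the arguments say whether p, respectively q, divides the vertex (is outside its support).
weight : Bool → Bool → ℕ
weight false false = 0
weight false true  = 1
weight true  false = 3
weight true  true  = 4

-- The first argument of `weight` counts 3 and the second counts 1. A total of 4 arises from two 3s,
-- or from a single 3 and at least one 1; without a 3 the total is at most 2.
4≤weight+weight⇔ : {A B A′ B′ : Set a} (A? : Dec A) (B? : Dec B) (A′? : Dec A′) (B′? : Dec B′) →
  4 ℕ.≤ weight (does A?) (does B?) ℕ.+ weight (does A′?) (does B′?) ⇔
  ((A ⊎ A′) × (B ⊎ B′ ⊎ A × A′))
4≤weight+weight⇔ A? B? A′? B′? = mk⇔ (to A? B? A′? B′?) (from A? B? A′? B′?)
  where
  to : {A B A′ B′ : Set a} (A? : Dec A) (B? : Dec B) (A′? : Dec A′) (B′? : Dec B′) →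
    4 ℕ.≤ weight (does A?) (does B?) ℕ.+ weight (does A′?) (does B′?) →
    (A ⊎ A′) × (B ⊎ B′ ⊎ A × A′)
  to (yes x) _       (yes x′) _        _ = inj₁ x , inj₂ (inj₂ (x , x′))
  to (yes x) (yes y) (no _)   _        _ = inj₁ x , inj₁ y
  to (yes x) (no _)  (no _)   (yes y′) _ = inj₁ x , inj₂ (inj₁ y′)
  to (no _)  (yes y) (yes x′) _        _ = inj₂ x′ , inj₁ y
  to (no _)  (no _)  (yes x′) (yes y′) _ = inj₂ x′ , inj₂ (inj₁ y′)
  to (yes _) (no _)  (no _)   (no _)   (ℕ.s≤s (ℕ.s≤s (ℕ.s≤s ())))
  to (no _)  (no _)  (yes _)  (no _)   (ℕ.s≤s (ℕ.s≤s (ℕ.s≤s ())))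
  to (no _)  (yes _) (no _)   (yes _)  (ℕ.s≤s (ℕ.s≤s ()))
  to (no _)  (yes _) (no _)   (no _)   (ℕ.s≤s ())
  to (no _)  (no _)  (no _)   (yes _)  (ℕ.s≤s ())
  to (no _)  (no _)  (no _)   (no _)   ()

  from : {A B A′ B′ : Set a} (A? : Dec A) (B? : Dec B) (A′? : Dec A′) (B′? : Dec B′) →
    (A ⊎ A′) × (B ⊎ B′ ⊎ A × A′) →
    4 ℕ.≤ weight (does A?) (does B?) ℕ.+ weight (does A′?) (does B′?)
  from (yes _) (yes _) _       _        _ = ℕ.m≤m+n 4 _
  from (yes _) (no _)  (yes _) (yes _)  _ = ℕ.m≤m+n 4 _
  from (yes _) (no _)  (yes _) (no _)   _ = ℕ.m≤m+n 4 _
  from (yes _) (no _)  (no _)  (yes _)  _ = ℕ.≤-refl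
  from (yes _) (no ¬y) (no ¬x′) (no ¬y′) (_ , y) =
    contradiction y [ ¬y , [ ¬y′ , ¬x′ ∘ proj₂ ]′ ]′
  from (no _)  (yes _) (yes _) (yes _)  _ = ℕ.m≤m+n 4 _
  from (no _)  (yes _) (yes _) (no _)   _ = ℕ.≤-refl
  from (no _)  (no _)  (yes _) (yes _)  _ = ℕ.≤-refl
  from (no ¬x) (no ¬y) (yes _) (no ¬y′) (_ , y) =
    contradiction y [ ¬y , [ ¬y′ , ¬x ∘ proj₁ ]′ ]′
  from (no ¬x) _       (no ¬x′) _       (x , _) = contradiction x [ ¬x , ¬x′ ]′

-- Excluded middle, cancellation and prime powers in a principal ideal domain.

module PID (R : CommutativeRing c ℓ) (pid : RingTheory.IsPrincipalIdealDomain R) where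
  open CommutativeRing R hiding (zero) renaming (_+_ to _+ᴿ_; _-_ to _-ᴿ_)
  open RingTheory R
  open Algebra.Definitions.RawMagma *-rawMagma using (_,_)
  open Algebra.Properties.Ring ring
    using (x[y-z]≈xy-xz; [y-z]x≈yx-zx; x∙y⁻¹≈ε⇒x≈y; x≈y⇒x∙y⁻¹≈ε)
  open Algebra.Properties.CommutativeSemigroup *-commutativeSemigroup
    using (interchange; x∙yz≈y∙xz; x∙yz≈xy∙z)
  open Algebra.Properties.CommutativeMonoid.Sum *-commutativeMonoid
    using () renaming (sum-remove to product-remove)
  open IsPrincipalIdealDomain pid public
  open Divisibility R public

  -- A generator g of { x | x ≈ 0 or P } is zero exactly when P fails.
  em : ExcludedMiddle (c ⊔ ℓ)
  em {P} with principal I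
    where
    I : Ideal
    I = record
      { Member   = λ x → x ≈ 0# ⊎ P
      ; resp     = λ { x≈y (inj₁ x≈0) → inj₁ (trans (sym x≈y) x≈0) ; _ (inj₂ p) → inj₂ p }
      ; 0∈       = inj₁ refl
      ; +-closed = λ { (inj₁ x≈0) (inj₁ y≈0) → inj₁ (trans (+-cong x≈0 y≈0) (+-identityʳ 0#))
                     ; (inj₁ _) (inj₂ p) → inj₂ p ; (inj₂ p) _ → inj₂ p }
      ; *-closed = λ { r (inj₁ x≈0) → inj₁ (trans (*-congˡ x≈0) (zeroʳ r)) ; _ (inj₂ p) → inj₂ p }
      }
  ... | g , I⊆⟨g⟩ , ⟨g⟩⊆I with ⟨g⟩⊆I (∣ʳ-refl {g})
  ...   | inj₂ p   = yes p
  ...   | inj₁ g≈0 = no λ p → 1≉0 (1≈0 (I⊆⟨g⟩ {1#} (inj₂ p)))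
    where
    1≈0 : g ∣ 1# → 1# ≈ 0#
    1≈0 (q , qg≈1) = trans (sym qg≈1) (trans (*-congˡ g≈0) (zeroʳ q))

  *-cancelˡ : ∀ {x y z} → x ≉ 0# → x * y ≈ x * z → y ≈ z
  *-cancelˡ {x} {y} {z} x≉0 xy≈xz
    with noZeroDiv (trans (x[y-z]≈xy-xz x y z) (x≈y⇒x∙y⁻¹≈ε xy≈xz))
  ... | inj₁ x≈0   = contradiction x≈0 x≉0
  ... | inj₂ y-z≈0 = x∙y⁻¹≈ε⇒x≈y y z y-z≈0

  *-cancelˡ-∣ : ∀ {x y z} → x ≉ 0# → x * y ∣ x * z → y ∣ z
  *-cancelˡ-∣ {x} {y} x≉0 (q , q[xy]≈xz) = q , *-cancelˡ x≉0 (trans (x∙yz≈y∙xz x q y) q[xy]≈xz)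

  x^n≉0 : ∀ {x} → x ≉ 0# → ∀ n → x ^ n ≉ 0#
  x^n≉0 x≉0 zero    1≈0 = 1≉0 1≈0
  x^n≉0 x≉0 (suc n) xxⁿ≈0 with noZeroDiv xxⁿ≈0
  ... | inj₁ x≈0  = x≉0 x≈0
  ... | inj₂ xⁿ≈0 = x^n≉0 x≉0 n xⁿ≈0

  -- Primes are irreducible: in `q ≈ r * p`, if `q` divided `r`, cancelling `q` would make `p` a
  -- unit. This turns non-associated primes into primes that do not divide each other.
  prime∣prime⇒∣ : ∀ {p q} → Prime p → Prime q → p ∣ q → q ∣ p
  prime∣prime⇒∣ {p} {q} p-prime q-prime (r , rp≈q)
    with Prime.split-∣ q-prime (∣ʳ-respʳ-≈ (sym rp≈q) ∣ʳ-refl)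
  ... | inj₂ q∣p = q∣p
  ... | inj₁ (s , sq≈r) = contradiction
    (s , *-cancelˡ (Prime.p≉0 q-prime) (trans (x∙yz≈y∙xz q s p)
      (trans (trans (sym (*-assoc s q p)) (*-congʳ sq≈r)) (trans rp≈q (sym (*-identityʳ q))))))
    (Prime.p∤1 p-prime)

  -- Induction on `m`: with `x ≈ x′ * p ^ i` and `y ≈ y′ * p ^ j`, cancelling `p ^ m` leaves
  -- `p ∣ x′ * y′`, and primality decides which exponent grows.
  prime-power-split : ∀ {p} → Prime p → ∀ m {x y} → p ^ m ∣ x * y →
    ∃ λ i → ∃ λ j → i ℕ.+ j ≡ m × p ^ i ∣ x × p ^ j ∣ y
  prime-power-split p-prime zero {x} {y} _ = 0 , 0 , ≡.refl , (1∣ x) , (1∣ y)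
  prime-power-split {p} p-prime (suc m) {x} {y} pᵐ⁺¹∣xy
    with prime-power-split p-prime m (∣ʳ-trans (x∣ʳyx (p ^ m) p) pᵐ⁺¹∣xy)
  ... | i , j , ≡.refl , (x′ , x′pⁱ≈x) , (y′ , y′pʲ≈y)
    with Prime.split-∣ p-prime (*-cancelˡ-∣ (x^n≉0 (Prime.p≉0 p-prime) m)
           (∣ʳ-respˡ-≈ (*-comm p (p ^ m)) (∣ʳ-respʳ-≈ xy≈pᵐx′y′ pᵐ⁺¹∣xy)))
    where
    xy≈pᵐx′y′ : x * y ≈ p ^ m * (x′ * y′)
    xy≈pᵐx′y′ = trans (sym (*-cong x′pⁱ≈x y′pʲ≈y)) (trans (interchange x′ (p ^ i) y′ (p ^ j))
      (trans (*-congˡ (sym (^-homo-* p i j))) (*-comm (x′ * y′) (p ^ m))))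
  ...   | inj₁ p∣x′ = suc i , j , ≡.refl
        , ∣ʳ-respʳ-≈ x′pⁱ≈x (x∣ʳy⇒xz∣ʳyz (p ^ i) p∣x′) , (y′ , y′pʲ≈y)
  ...   | inj₂ p∣y′ = i , suc j , ℕ.+-suc i j
        , (x′ , x′pⁱ≈x) , ∣ʳ-respʳ-≈ y′pʲ≈y (x∣ʳy⇒xz∣ʳyz (p ^ j) p∣y′)

  prime-power∣xy∧p∤y⇒∣x : ∀ {p} → Prime p → ∀ m {x y} → p ^ m ∣ x * y → ¬ p ∣ y → p ^ m ∣ x
  prime-power∣xy∧p∤y⇒∣x {p} p-prime m {x} pᵐ∣xy p∤y with prime-power-split p-prime m pᵐ∣xy
  ... | i , zero  , i+0≡m , pⁱ∣x , _ =
    ≡.subst (λ k → p ^ k ∣ x) (≡.trans (≡.sym (ℕ.+-identityʳ i)) i+0≡m) pⁱ∣x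
  ... | i , suc j , _ , _ , p¹⁺ʲ∣y = contradiction (∣ʳ-trans (x∣xy p (p ^ j)) p¹⁺ʲ∣y) p∤y

  -- Write `x` as `z` times the product of the later prime powers. The first prime does not divide
  -- that product, so its power divides `z`.
  product-prime-powers∣ : ∀ {n} (p : Fin n → Carrier) (m : Fin n → ℕ) → (∀ i → Prime (p i)) →
    (∀ i j → i ≢ j → ¬ p i ∣ p j) → ∀ {x} → (∀ i → p i ^ m i ∣ x) → product (λ i → p i ^ m i) ∣ x
  product-prime-powers∣ {zero}  p m p-prime p∤p {x} _ = 1∣ x
  product-prime-powers∣ {suc n} p m p-prime p∤p pᵐ∣x
    with product-prime-powers∣ (p ∘ suc) (m ∘ suc) (p-prime ∘ suc)
           (λ i j i≢j → p∤p (suc i) (suc j) (i≢j ∘ Fin.suc-injective)) (pᵐ∣x ∘ suc)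
  ... | z , z∏≈x = ∣ʳ-respʳ-≈ z∏≈x (x∣ʳy⇒xz∣ʳyz _
    (prime-power∣xy∧p∤y⇒∣x (p-prime zero) (m zero) (∣ʳ-respʳ-≈ (sym z∏≈x) (pᵐ∣x zero))
      (prime∤product (p-prime zero) _ λ i →
        prime∤power (p-prime zero) (p∤p zero (suc i) λ ()) (m (suc i)))))

  -- Truncated valuations.

  -- The minimum of `m` and the `p`-adic valuation. The cut-off gives a value at `0#` too, and makes
  -- it depend on `x` modulo `p ^ m` only.
  truncatedValuation : ∀ p m x →
    ∃ λ k → k ℕ.≤ m × p ^ k ∣ x × (∀ i → i ℕ.≤ m → p ^ i ∣ x → i ℕ.≤ k)
  truncatedValuation p zero    x = 0 , ℕ.z≤n , (1∣ x) , λ _ i≤0 _ → i≤0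
  truncatedValuation p (suc m) x with em {p ^ suc m ∣ x}
  ... | yes pᵐ⁺¹∣x = suc m , ℕ.≤-refl , pᵐ⁺¹∣x , λ _ i≤m _ → i≤m
  ... | no  pᵐ⁺¹∤x with truncatedValuation p m x
  ...   | k , k≤m , pᵏ∣x , maximal = k , ℕ.m≤n⇒m≤1+n k≤m , pᵏ∣x , maximal′
    where
    maximal′ : ∀ i → i ℕ.≤ suc m → p ^ i ∣ x → i ℕ.≤ k
    maximal′ i i≤1+m pⁱ∣x with ℕ.m≤n⇒m<n∨m≡n i≤1+m
    ... | inj₁ i<1+m  = maximal i (ℕ.s≤s⁻¹ i<1+m) pⁱ∣x
    ... | inj₂ ≡.refl = contradiction pⁱ∣x pᵐ⁺¹∤x

  val : Carrier → ℕ → Carrier → ℕ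
  val p m x = proj₁ (truncatedValuation p m x)

  val-mono : ∀ p m {x y} → x ≈ y [mod p ^ m ] → val p m x ℕ.≤ val p m y
  val-mono p m {x} {y} x≈y with truncatedValuation p m x | truncatedValuation p m y
  ... | k , k≤m , pᵏ∣x , _ | _ , _ , _ , maximal =
    maximal k k≤m (∣-resp-mod (∣ʳ-trans (x^m∣x^n p k≤m) x≈y) pᵏ∣x)

  val-cong : ∀ p m {x y} → x ≈ y [mod p ^ m ] → val p m x ≡ val p m y
  val-cong p m {x} {y} x≈y = ℕ.≤-antisym
    (val-mono p m x≈y) (val-mono p m (Mod.sym (p ^ m) {x} {y} x≈y))

  -- Forward, the exponents of `prime-power-split` add up to `m`, so each is at most `m` and hence
  -- bounded by the truncated valuation. Backward, multiply the two powers.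
  prime-power∣xy⇔≤val+val : ∀ {p} → Prime p → ∀ m x y →
    p ^ m ∣ x * y ⇔ m ℕ.≤ val p m x ℕ.+ val p m y
  prime-power∣xy⇔≤val+val {p} p-prime m x y with truncatedValuation p m x | truncatedValuation p m y
  ... | k , k≤m , pᵏ∣x , x-maximal | l , l≤m , pˡ∣y , y-maximal = mk⇔ forward λ m≤k+l →
    ∣ʳ-trans (x^m∣x^n p m≤k+l) (∣ʳ-respˡ-≈ (sym (^-homo-* p k l)) (∙-cong-∣ pᵏ∣x pˡ∣y))
    where
    forward : p ^ m ∣ x * y → m ℕ.≤ k ℕ.+ l
    forward pᵐ∣xy with prime-power-split p-prime m pᵐ∣xy
    ... | i , j , ≡.refl , pⁱ∣x , pʲ∣y = ℕ.+-mono-≤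
      (x-maximal i (ℕ.m≤m+n i j) pⁱ∣x) (y-maximal j (ℕ.m≤n+m j i) pʲ∣y)

  -- Residue rings with two or with more elements.

  HasTwoResidues : Carrier → Set _
  HasTwoResidues p = HasCardinality (CommutativeRing.setoid (Quotient ⟨ p ⟩)) 2

  -- In `Fin 2` the images of `x` and `y` both avoid that of `0#`, so they coincide.
  twoResidues⇒≈ : ∀ {p x y} → HasTwoResidues p → ¬ p ∣ x → ¬ p ∣ y → x ≈ y [mod p ]
  twoResidues⇒≈ {p} {x} {y} R/p≅2 p∤x p∤y = from-injective
    (other-unique (from 0#) (from x) (from y)
      (λ eq → p∤x (≈0⇒∣ (Mod.sym p (from-injective eq))))
      (λ eq → p∤y (≈0⇒∣ (Mod.sym p (from-injective eq)))))
    where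
    open Inverse R/p≅2
    from-injective : ∀ {x y} → from x ≡ from y → x ≈ y [mod p ]
    from-injective {x} {y} eq = Mod.trans p (Mod.sym p (strictlyInverseˡ x))
      (≡.subst (λ i → to i ≈ y [mod p ]) (≡.sym eq) (strictlyInverseˡ y))
    other-unique : (i j k : Fin 2) → i ≢ j → i ≢ k → j ≡ k
    other-unique zero       zero       _          i≢j _   = contradiction ≡.refl i≢j
    other-unique zero       (suc zero) zero       _   i≢k = contradiction ≡.refl i≢k
    other-unique zero       (suc zero) (suc zero) _   _   = ≡.refl
    other-unique (suc zero) zero       zero       _   _   = ≡.refl
    other-unique (suc zero) zero       (suc zero) _   i≢k = contradiction ≡.refl i≢k
    other-unique (suc zero) (suc zero) _          i≢j _   = contradiction ≡.refl i≢j

  -- Multiplying a cofactor of `g` by such an `x` yields a different vertex with the same support.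
  ThirdResidue : Carrier → Set _
  ThirdResidue p = ∃ λ x → ¬ p ∣ x × ¬ 1# ≈ x [mod p ]

  -- Without a third residue every element is congruent to `0#` or `1#`, which enumerates the
  -- residue ring by `Fin 2`.
  ¬twoResidues⇒thirdResidue : ∀ {p} → Prime p → ¬ HasTwoResidues p → ThirdResidue p
  ¬twoResidues⇒thirdResidue {p} p-prime ¬two = decidable-stable em λ ¬third → ¬two (two ¬third)
    where
    module _ (¬third : ¬ ThirdResidue p) where
      to : Fin 2 → Carrier
      to zero       = 0#
      to (suc zero) = 1#

      residue : ∀ x → ∃ λ i → to i ≈ x [mod p ]
      residue x with em {p ∣ x}
      ... | yes p∣x = zero , Mod.sym p (∣⇒≈0 p∣x)
      ... | no  p∤x = suc zero , decidable-stable em λ 1≉x → ¬third (x , p∤x , 1≉x)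

      to-injective : ∀ {i j} → to i ≈ to j [mod p ] → i ≡ j
      to-injective {zero}     {zero}     _   = ≡.refl
      to-injective {zero}     {suc zero} 0≈1 =
        contradiction (≈0⇒∣ (Mod.sym p {0#} {1#} 0≈1)) (Prime.p∤1 p-prime)
      to-injective {suc zero} {zero}     1≈0 = contradiction (≈0⇒∣ 1≈0) (Prime.p∤1 p-prime)
      to-injective {suc zero} {suc zero} _   = ≡.refl

      two : HasTwoResidues p
      two = record
        { to        = to
        ; from      = λ x → proj₁ (residue x)
        ; to-cong   = λ { ≡.refl → Mod.refl p }
        ; from-cong = λ {x} {y} x≈y → to-injective (Mod.trans p (proj₂ (residue x))
            (Mod.trans p x≈y (Mod.sym p (proj₂ (residue y)))))
        ; inverse   =
            (λ {x} → λ { ≡.refl → proj₂ (residue x) })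
          , (λ {i} {x} x≈i → to-injective (Mod.trans p (proj₂ (residue x)) x≈i))
        }

  threeResidues⇒thirdResidue : ∀ {p} → Prime p →
    HasCardinality≥ (CommutativeRing.setoid (Quotient ⟨ p ⟩)) 3 → ThirdResidue p
  threeResidues⇒thirdResidue {p} p-prime three = ¬twoResidues⇒thirdResidue p-prime λ two →
    contradiction (Fin.injective⇒≤ {f = λ i → Inverse.from two (to i)} λ {i} {j} eq →
      injective (Mod.trans p (Mod.sym p (Inverse.strictlyInverseˡ two (to i)))
        (≡.subst (λ x → Inverse.to two x ≈ to j [mod p ]) (≡.sym eq)
          (Inverse.strictlyInverseˡ two (to j)))))
      λ { (ℕ.s≤s (ℕ.s≤s ())) }
    where open Injection three

  -- The prime factorization of `g` and its cofactors; the number of primes is `suc k`.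

  module Factorization
    (g : Carrier) (k : ℕ) (u : Carrier) (p : Fin (suc k) → Carrier) (m : Fin (suc k) → ℕ)
    (u-unit : IsUnit u) (p-prime : ∀ i → Prime (p i)) (p∦p : ∀ i j → i ≢ j → p i ∦ p j)
    (m≥1 : ∀ i → m i ≥ 1) (g≈up : g ≈ u * product (λ i → p i ^ m i))
    where
    open Equivalence using (to; from)

    private
      Q = Quotient ⟨ g ⟩
      Γ = zeroDivisorGraph Q

    p∤p : ∀ i j → i ≢ j → ¬ p i ∣ p j
    p∤p i j i≢j pᵢ∣pⱼ = p∦p i j i≢j (pᵢ∣pⱼ , prime∣prime⇒∣ (p-prime i) (p-prime j) pᵢ∣pⱼ)

    prime-power∣g : ∀ i → p i ^ m i ∣ g
    prime-power∣g i = ∣ʳ-respʳ-≈ (sym g≈up) (x∣ʳy⇒x∣ʳzy u (fᵢ∣product (λ i → p i ^ m i) i))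

    p∣p^m : ∀ i → p i ∣ p i ^ m i
    p∣p^m i = x∣x^n (p i) (m≥1 i)

    p∣g : ∀ i → p i ∣ g
    p∣g i = ∣ʳ-trans (p∣p^m i) (prime-power∣g i)

    -- The prime powers are pairwise coprime, so their product divides `x`; the unit `u` is absorbed
    -- by `u ∣ 1#`.
    g∣-intro : ∀ {x} → (∀ i → p i ^ m i ∣ x) → g ∣ x
    g∣-intro {x} pᵐ∣x = ∣ʳ-respˡ-≈ (sym g≈up) (∣ʳ-respʳ-≈ (*-identityˡ x)
      (∙-cong-∣ u-unit (product-prime-powers∣ p m p-prime p∤p pᵐ∣x)))

    -- This is `eᵢ`, formed without division; the factor `u` makes `p^m*cofactor≈g` an equation
    -- rather than an association.
    cofactor : Fin (suc k) → Carrier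
    cofactor i = u * product (λ j → p (punchIn i j) ^ m (punchIn i j))

    p^m*cofactor≈g : ∀ i → p i ^ m i * cofactor i ≈ g
    p^m*cofactor≈g i = trans (x∙yz≈y∙xz (p i ^ m i) u _)
      (trans (*-congˡ (sym (product-remove {i = i} (λ j → p j ^ m j)))) (sym g≈up))

    p^m∣cofactor : ∀ {i j} → i ≢ j → p j ^ m j ∣ cofactor i
    p^m∣cofactor {i} {j} i≢j = x∣ʳy⇒x∣ʳzy u
      (≡.subst (λ j → p j ^ m j ∣ _) (Fin.punchIn-punchOut i≢j)
      (fᵢ∣product (λ j → p (punchIn i j) ^ m (punchIn i j)) (punchOut i≢j)))

    p∣cofactor : ∀ {i j} → i ≢ j → p j ∣ cofactor i
    p∣cofactor {i} {j} i≢j = ∣ʳ-trans (p∣p^m j) (p^m∣cofactor i≢j)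

    p∤cofactor : ∀ i → ¬ p i ∣ cofactor i
    p∤cofactor i p∣G with Prime.split-∣ (p-prime i) p∣G
    ... | inj₁ p∣u = Prime.p∤1 (p-prime i) (∣ʳ-trans p∣u u-unit)
    ... | inj₂ p∣∏ = prime∤product (p-prime i) _ (λ j → prime∤power (p-prime i)
      (p∤p i (punchIn i j) (Fin.punchInᵢ≢i i j ∘ ≡.sym)) (m (punchIn i j))) p∣∏

    p∤xy : ∀ i {x y} → ¬ p i ∣ x → ¬ p i ∣ y → ¬ p i ∣ x * y
    p∤xy i p∤x p∤y p∣xy = [ p∤x , p∤y ]′ (Prime.split-∣ (p-prime i) p∣xy)

    -- Every index `l` differs from `i` or from `j`, and the corresponding cofactor contains the
    -- full power of `p l`.
    cofactor*cofactor : ∀ {i j} → i ≢ j → g ∣ cofactor i * cofactor j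
    cofactor*cofactor {i} {j} i≢j = g∣-intro λ l → divides l (i Fin.≟ l)
      where
      divides : ∀ l → Dec (i ≡ l) → p l ^ m l ∣ cofactor i * cofactor j
      divides l (yes ≡.refl) = x∣ʳy⇒x∣ʳzy (cofactor i) (p^m∣cofactor (i≢j ∘ ≡.sym))
      divides l (no i≢l)     = x∣y⇒x∣yz (cofactor j) (p^m∣cofactor i≢l)

    -- Upper bounds.

    dimension≤ : IsIntersectionOfThresholdGraphs Γ (suc k)
    dimension≤ = isIntersectionOfThresholdGraphs Γ (λ j (r , _) → val (p j) (m j) r) m
      (λ j {v} {w} v≈w → val-cong (p j) (m j) {proj₁ v} {proj₁ w} (∣ʳ-trans (prime-power∣g j) v≈w))
      λ (r , _) (s , _) r≉s → mk⇔
        (λ (_ , rs≈0) j → to (prime-power∣xy⇔≤val+val (p-prime j) (m j) r s)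
          (∣ʳ-trans (prime-power∣g j) (≈0⇒∣ rs≈0)))
        (λ m≤ → r≉s , ∣⇒≈0 (g∣-intro λ j →
          from (prime-power∣xy⇔≤val+val (p-prime j) (m j) r s) (m≤ j)))

    squarefree-g∣-intro : (∀ i → m i ≡ 1) → ∀ {x} → (∀ i → p i ∣ x) → g ∣ x
    squarefree-g∣-intro m≡1 p∣x = g∣-intro λ i →
      ∣ʳ-respˡ-≈ (sym (trans (reflexive (≡.cong (p i ^_) (m≡1 i))) (*-identityʳ (p i)))) (p∣x i)

    -- Each prime `q` other than `p i₀` gets one threshold graph: `q` must divide `r` or `s`, and
    -- either `p i₀` divides one of them or `q` divides both.
    squarefreeDimension≤ : (∀ i → m i ≡ 1) → ∀ i₀ → HasTwoResidues (p i₀) →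
      IsIntersectionOfThresholdGraphs Γ k
    squarefreeDimension≤ m≡1 i₀ two = isIntersectionOfThresholdGraphs Γ
      (λ j (r , _) → weight (does (em {p (punchIn i₀ j) ∣ r})) (does (em {p i₀ ∣ r}))) (λ _ → 4)
      (λ j {v} {w} v≈w → ≡.cong₂ weight
        (does-⇔ (p∣-cong (punchIn i₀ j) {proj₁ v} {proj₁ w} v≈w) em em)
        (does-⇔ (p∣-cong i₀ {proj₁ v} {proj₁ w} v≈w) em em))
      λ (r , _) (s , _) r≉s → mk⇔
        (λ (_ , rs≈0) j → from (4≤weight+weight⇔ em em em em)
          ( Prime.split-∣ (p-prime (punchIn i₀ j)) (∣ʳ-trans (p∣g (punchIn i₀ j)) (≈0⇒∣ rs≈0))
          , [ inj₁ , inj₂ ∘ inj₁ ]′ (Prime.split-∣ (p-prime i₀) (∣ʳ-trans (p∣g i₀) (≈0⇒∣ rs≈0)))))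
        (λ 4≤ → r≉s , ∣⇒≈0 (g∣rs r≉s λ j → to (4≤weight+weight⇔ em em em em) (4≤ j)))
      where
      p∣-cong : ∀ i {x y} → x ≈ y [mod g ] → p i ∣ x ⇔ p i ∣ y
      p∣-cong i {x} {y} x≈y = mk⇔ (∣-resp-mod (∣ʳ-trans (p∣g i) x≈y))
        (∣-resp-mod (∣ʳ-trans (p∣g i) (Mod.sym g {x} {y} x≈y)))

      g∣ : ∀ {x} → p i₀ ∣ x → (∀ j → p (punchIn i₀ j) ∣ x) → g ∣ x
      g∣ {x} p₀∣x p∣x = squarefree-g∣-intro m≡1 λ i → divides i (i₀ Fin.≟ i)
        where
        divides : ∀ i → Dec (i₀ ≡ i) → p i ∣ x
        divides i (yes ≡.refl) = p₀∣x
        divides i (no i₀≢i)    =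
          ≡.subst (λ i → p i ∣ x) (Fin.punchIn-punchOut i₀≢i) (p∣x (punchOut i₀≢i))

      g∣rs : ∀ {r s} → ¬ r ≈ s [mod g ] →
        (∀ j → let q = p (punchIn i₀ j) in
          (q ∣ r ⊎ q ∣ s) × (p i₀ ∣ r ⊎ p i₀ ∣ s ⊎ q ∣ r × q ∣ s)) →
        g ∣ r * s
      g∣rs {r} {s} r≉s edge = g∣ p₀∣rs λ j → [ x∣y⇒x∣yz s , x∣ʳy⇒x∣ʳzy r ]′ (proj₁ (edge j))
        where
        p₀∣rs : p i₀ ∣ r * s
        p₀∣rs with em {p i₀ ∣ r} | em {p i₀ ∣ s}
        ... | yes p₀∣r | _        = x∣y⇒x∣yz s p₀∣r
        ... | no _     | yes p₀∣s = x∣ʳy⇒x∣ʳzy r p₀∣s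
        -- Now every other prime divides both `r` and `s`, and both are the nonzero class modulo
        -- `p i₀`. So `r` and `s` agree modulo every prime, hence modulo `g`.
        ... | no p₀∤r  | no p₀∤s  = contradiction
          (g∣ (twoResidues⇒≈ {x = r} {s} two p₀∤r p₀∤s) λ j →
            let q = p (punchIn i₀ j)
                q∣r , q∣s = [ (λ p₀∣r → contradiction p₀∣r p₀∤r)
                            , [ (λ p₀∣s → contradiction p₀∣s p₀∤s) , (λ q∣ → q∣) ]′ ]′
                          (proj₂ (edge j))
            in Mod.trans q {r} {0#} {s} (∣⇒≈0 q∣r) (Mod.sym q {s} {0#} (∣⇒≈0 q∣s)))
          r≉s

    -- Lower bounds.

    -- The prime `p (ι j)` divides `a i` but not `b j`, which keeps these two vertices distinct. The
    -- map `ι` lets the pairs range over only some of the primes.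
    crossing⇒≤dimension : ∀ {n} (ι : Fin n → Fin (suc k)) (a b : Fin n → Carrier) →
      (∀ i → IsZeroDivisor Q (a i)) → (∀ i → IsZeroDivisor Q (b i)) →
      (∀ i → ¬ a i ≈ b i [mod g ]) → (∀ i → ¬ g ∣ a i * b i) →
      (∀ i j → i ≢ j → p (ι j) ∣ a i) → (∀ j → ¬ p (ι j) ∣ b j) →
      (∀ i j → i ≢ j → g ∣ a i * b j) →
      ∀ d → IsIntersectionOfThresholdGraphs Γ d → n ℕ.≤ d
    crossing⇒≤dimension ι a b a-zd b-zd a≉b ab≉0 p∣a p∤b ab′≈0 = zeroDivisorCrossing⇒≤ Q em a b
      a-zd b-zd a≉b (λ i → ab≉0 i ∘ ≈0⇒∣)
      (λ i j i≢j a≈b → p∤b j (∣-resp-mod (∣ʳ-trans (p∣g (ι j)) a≈b) (p∣a i j i≢j)))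
      (λ i j i≢j → ∣⇒≈0 (ab′≈0 i j i≢j))

    -- Given two pairs, zero divisors come for free: `a i` and `b i` are annihilated by the `b j`
    -- and `a j` of another pair.
    crossing⇒≤dimension′ : ∀ {n} →
      let N = suc (suc n) in (ι : Fin N → Fin (suc k)) (a b : Fin N → Carrier) →
      (∀ i → ¬ a i ≈ b i [mod g ]) → (∀ i → ¬ g ∣ a i * b i) →
      (∀ i j → i ≢ j → p (ι j) ∣ a i) → (∀ j → ¬ p (ι j) ∣ b j) →
      (∀ i j → i ≢ j → g ∣ a i * b j) →
      ∀ d → IsIntersectionOfThresholdGraphs Γ d → suc (suc n) ℕ.≤ d
    crossing⇒≤dimension′ ι a b a≉b ab≉0 p∣a p∤b ab′≈0 = crossing⇒≤dimension ι a b
      (λ i → let j , i≢j = another (ℕ.s≤s ℕ.z≤n) i in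
          b j , (λ b≈0 → ab≉0 j (x∣ʳy⇒x∣ʳzy (a j) (≈0⇒∣ b≈0)))
        , ∣⇒≈0 (ab′≈0 i j i≢j))
      (λ i → let j , i≢j = another (ℕ.s≤s ℕ.z≤n) i in
          a j , (λ a≈0 → ab≉0 j (x∣y⇒x∣yz (b j) (≈0⇒∣ a≈0)))
        , ∣⇒≈0 (∣ʳ-respʳ-≈ (*-comm (a j) (b i)) (ab′≈0 j i (i≢j ∘ ≡.sym))))
      a≉b ab≉0 p∣a p∤b ab′≈0

    1≉c⇒G≉cG : ∀ i {c} → ¬ 1# ≈ c [mod p i ] → ¬ cofactor i ≈ c * cofactor i [mod g ]
    1≉c⇒G≉cG i {c} 1≉c G≈cG with Prime.split-∣ (p-prime i)
      (∣ʳ-respʳ-≈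
        (sym (trans ([y-z]x≈yx-zx (cofactor i) 1# c) (+-congʳ (*-identityˡ (cofactor i)))))
        (∣ʳ-trans (p∣g i) G≈cG))
    ... | inj₁ p∣1-c = 1≉c p∣1-c
    ... | inj₂ p∣G   = p∤cofactor i p∣G

    -- Modulo `p i` the product reduces to the square of the cofactor.
    g∤G*G+y : ∀ i {y} → g ∣ cofactor i * y → ¬ g ∣ cofactor i * (cofactor i +ᴿ y)
    g∤G*G+y i {y} g∣Gy g∣G[G+y] = p∤xy i (p∤cofactor i) (p∤cofactor i)
      (∣ʳ-trans (p∣g i) (∣x+y∧∣y⇒∣x
        (∣ʳ-respʳ-≈ (distribˡ (cofactor i) (cofactor i) y) g∣G[G+y]) g∣Gy))

    thirdResidues⇒≤dimension : k ≥ 1 → (∀ i → ThirdResidue (p i)) →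
      ∀ d → IsIntersectionOfThresholdGraphs Γ d → suc k ℕ.≤ d
    thirdResidues⇒≤dimension (ℕ.s≤s _) third = crossing⇒≤dimension′ (λ i → i) cofactor
      (λ i → proj₁ (third i) * cofactor i)
      (λ i → 1≉c⇒G≉cG i (proj₂ (proj₂ (third i))))
      (λ i g∣ → p∤xy i (p∤cofactor i) (p∤xy i (proj₁ (proj₂ (third i))) (p∤cofactor i))
        (∣ʳ-trans (p∣g i) g∣))
      (λ i j → p∣cofactor)
      (λ j → p∤xy j (proj₁ (proj₂ (third j))) (p∤cofactor j))
      (λ i j i≢j → ∣ʳ-respʳ-≈ (x∙yz≈y∙xz (proj₁ (third j)) (cofactor i) (cofactor j))
        (x∣ʳy⇒x∣ʳzy (proj₁ (third j)) (cofactor*cofactor i≢j)))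

    -- Index zero is given up: `cofactor zero` is nonzero in `Q` but killed by all other cofactors,
    -- so adding it separates `b i` from `a i` and leaves every product intact.
    pred≤dimension : k ≥ 2 → ∀ d → IsIntersectionOfThresholdGraphs Γ d → k ℕ.≤ d
    pred≤dimension (ℕ.s≤s (ℕ.s≤s _)) = crossing⇒≤dimension′ suc (cofactor ∘ suc)
      (λ i → cofactor (suc i) +ᴿ cofactor zero)
      (λ i G≈G+G₀ → p∤cofactor zero (∣ʳ-trans (p∣g zero) (x≈x+y⇒∣y {x = cofactor (suc i)} G≈G+G₀)))
      (λ i → g∤G*G+y (suc i) (cofactor*cofactor {suc i} {zero} λ ()))
      (λ i j i≢j → p∣cofactor (i≢j ∘ Fin.suc-injective))
      (λ j p∣ → p∤cofactor (suc j) (∣x+y∧∣y⇒∣x p∣ (p∣cofactor {zero} {suc j} λ ())))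
      (λ i j i≢j → ∣ʳ-respʳ-≈ (sym (distribˡ (cofactor (suc i)) (cofactor (suc j)) (cofactor zero)))
        (∣x∧∣y⇒∣x+y
          (cofactor*cofactor (i≢j ∘ Fin.suc-injective)) (cofactor*cofactor {suc i} {zero} λ ())))

    module _ {i₀ : Fin (suc k)} (mᵢ₀≥2 : m i₀ ≥ 2) where
      private
        -- This is `g / p i₀`. It is nonzero in `Q`, is annihilated by every multiple of `p i₀`, and
        -- is divisible by every `p i`.
        h : Carrier
        h = p i₀ ^ (m i₀ ∸ 1) * cofactor i₀

        m≡1+[m-1] : m i₀ ≡ suc (m i₀ ∸ 1)
        m≡1+[m-1] = ≡.sym (ℕ.m+[n∸m]≡n (m≥1 i₀))

        p^m≈pp^[m-1] : p i₀ * p i₀ ^ (m i₀ ∸ 1) ≈ p i₀ ^ m i₀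
        p^m≈pp^[m-1] = reflexive (≡.cong (p i₀ ^_) (≡.sym m≡1+[m-1]))

        g∣ph : g ∣ p i₀ * h
        g∣ph = ∣ʳ-respʳ-≈ (sym (trans (x∙yz≈xy∙z (p i₀) _ (cofactor i₀))
          (trans (*-congʳ p^m≈pp^[m-1]) (p^m*cofactor≈g i₀)))) ∣ʳ-refl

        g∣xh : ∀ {x} → p i₀ ∣ x → g ∣ x * h
        g∣xh p∣x = ∣ʳ-trans g∣ph (∙-cong-∣ p∣x ∣ʳ-refl)

        p∣h : ∀ i → p i ∣ h
        p∣h i with i₀ Fin.≟ i
        -- As `m i₀ ≥ 2`, the exponent `m i₀ ∸ 1` is still positive.
        ... | yes ≡.refl = x∣y⇒x∣yz (cofactor i₀) (x∣x^n (p i₀) (ℕ.∸-monoˡ-≤ 1 mᵢ₀≥2))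
        ... | no i₀≢i    = x∣ʳy⇒x∣ʳzy (p i₀ ^ (m i₀ ∸ 1)) (p∣cofactor i₀≢i)

        cancel-power : ∀ {x} → p i₀ ^ m i₀ ∣ p i₀ ^ (m i₀ ∸ 1) * x → p i₀ ∣ x
        cancel-power = *-cancelˡ-∣ (x^n≉0 (Prime.p≉0 (p-prime i₀)) (m i₀ ∸ 1)) ∘
          ∣ʳ-respˡ-≈ (trans (sym p^m≈pp^[m-1]) (*-comm _ _))

        g∤h : ¬ g ∣ h
        g∤h g∣h = p∤cofactor i₀ (cancel-power (∣ʳ-trans (prime-power∣g i₀) g∣h))

        -- Cancelling one `p i₀` leaves a positive power of it dividing the square of the cofactor.
        g∤pG*G : ¬ g ∣ (p i₀ * cofactor i₀) * cofactor i₀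
        g∤pG*G g∣ = p∤xy i₀ (p∤cofactor i₀) (p∤cofactor i₀)
          (∣ʳ-trans (x∣x^n (p i₀) (ℕ.∸-monoˡ-≤ 1 mᵢ₀≥2))
          (*-cancelˡ-∣ (Prime.p≉0 (p-prime i₀)) (∣ʳ-respˡ-≈ (sym p^m≈pp^[m-1])
            (∣ʳ-respʳ-≈ (*-assoc _ _ _) (∣ʳ-trans (prime-power∣g i₀) g∣)))))

        -- The decision is an argument, so that properties of the pairs can be proved by matching on
        -- it.
        A B : ∀ i → Dec (i ≡ i₀) → Carrier
        A i (yes _) = p i * cofactor i
        A i (no _)  = cofactor i
        B i (yes _) = cofactor i
        B i (no _)  = cofactor i +ᴿ h

        A≉B : ∀ i i≟i₀ → ¬ A i i≟i₀ ≈ B i i≟i₀ [mod g ]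
        A≉B i (yes ≡.refl) pG≈G  = p∤cofactor i
          (∣-resp-mod {x = p i * cofactor i} (∣ʳ-trans (p∣g i) pG≈G) (x∣xy (p i) (cofactor i)))
        A≉B i (no _)       G≈G+h = g∤h (x≈x+y⇒∣y {x = cofactor i} G≈G+h)

        g∤AB : ∀ i i≟i₀ → ¬ g ∣ A i i≟i₀ * B i i≟i₀
        g∤AB i (yes ≡.refl) = g∤pG*G
        g∤AB i (no i≢i₀)    = g∤G*G+y i (g∣xh (p∣cofactor i≢i₀))

        p∣A : ∀ i j → i ≢ j → ∀ i≟i₀ → p j ∣ A i i≟i₀
        p∣A i j i≢j (yes _) = x∣ʳy⇒x∣ʳzy (p i) (p∣cofactor i≢j)
        p∣A i j i≢j (no _)  = p∣cofactor i≢j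

        p∤B : ∀ j j≟i₀ → ¬ p j ∣ B j j≟i₀
        p∤B j (yes _) = p∤cofactor j
        p∤B j (no _)  = λ p∣ → p∤cofactor j (∣x+y∧∣y⇒∣x p∣ (p∣h j))

        g∣A*cofactor : ∀ i j → i ≢ j → ∀ i≟i₀ → g ∣ A i i≟i₀ * cofactor j
        g∣A*cofactor i j i≢j (yes _) =
          ∣ʳ-respʳ-≈ (sym (*-assoc _ _ _)) (x∣ʳy⇒x∣ʳzy (p i) (cofactor*cofactor i≢j))
        g∣A*cofactor i j i≢j (no _)  = cofactor*cofactor i≢j

        -- Every `A i` is a multiple of `p i₀`: by the extra factor at `i₀`, as a cofactor
        -- elsewhere.
        g∣A*h : ∀ i i≟i₀ → g ∣ A i i≟i₀ * h
        g∣A*h i (yes ≡.refl) = g∣xh (x∣xy (p i) (cofactor i))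
        g∣A*h i (no i≢i₀)    = g∣xh (p∣cofactor i≢i₀)

        g∣AB′ : ∀ i j → i ≢ j → ∀ i≟i₀ j≟i₀ → g ∣ A i i≟i₀ * B j j≟i₀
        g∣AB′ i j i≢j i≟i₀ (yes _) = g∣A*cofactor i j i≢j i≟i₀
        g∣AB′ i j i≢j i≟i₀ (no _)  = ∣ʳ-respʳ-≈ (sym (distribˡ _ (cofactor j) h))
          (∣x∧∣y⇒∣x+y (g∣A*cofactor i j i≢j i≟i₀) (g∣A*h i i≟i₀))

      nonSquarefree⇒≤dimension : k ≥ 1 → ∀ d → IsIntersectionOfThresholdGraphs Γ d → suc k ℕ.≤ d
      nonSquarefree⇒≤dimension (ℕ.s≤s _) = crossing⇒≤dimension′ (λ i → i)
        (λ i → A i (i Fin.≟ i₀)) (λ i → B i (i Fin.≟ i₀))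
        (λ i → A≉B i (i Fin.≟ i₀)) (λ i → g∤AB i (i Fin.≟ i₀))
        (λ i j i≢j → p∣A i j i≢j (i Fin.≟ i₀)) (λ j → p∤B j (j Fin.≟ i₀))
        (λ i j i≢j → g∣AB′ i j i≢j (i Fin.≟ i₀) (j Fin.≟ i₀))

    -- A single non-edge rules out dimension 0. There is no second pair to supply annihilators, so
    -- `cofactor j` serves.
    thirdResidue⇒1≤dimension : ∀ {i j} → i ≢ j → ThirdResidue (p i) →
      ∀ d → IsIntersectionOfThresholdGraphs Γ d → 1 ℕ.≤ d
    thirdResidue⇒1≤dimension {i} {j} i≢j (c , p∤c , 1≉c) = crossing⇒≤dimension {n = 1} (λ _ → i)
      (λ _ → cofactor i) (λ _ → c * cofactor i)
      (λ _ → G′ , G′≉0 , ∣⇒≈0 (cofactor*cofactor i≢j))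
      (λ _ → G′ , G′≉0 , ∣⇒≈0 (∣ʳ-respʳ-≈ (sym (*-assoc c (cofactor i) G′))
        (x∣ʳy⇒x∣ʳzy c (cofactor*cofactor i≢j))))
      (λ _ → 1≉c⇒G≉cG i 1≉c)
      (λ _ g∣ → p∤xy i (p∤cofactor i) (p∤xy i p∤c (p∤cofactor i)) (∣ʳ-trans (p∣g i) g∣))
      (λ { zero zero 0≢0 → contradiction ≡.refl 0≢0 })
      (λ _ → p∤xy i p∤c (p∤cofactor i))
      (λ { zero zero 0≢0 → contradiction ≡.refl 0≢0 })
      where
      G′ = cofactor j
      G′≉0 : ¬ G′ ≈ 0# [mod g ]
      G′≉0 G′≈0 = p∤cofactor j (∣ʳ-trans (p∣g j) (≈0⇒∣ G′≈0))

    -- The complete graph.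

    -- If no prime divided `r`, all would divide the annihilator `s`, and `s` would vanish in `Q`.
    squarefree-zeroDivisor⇒p∣ : (∀ i → m i ≡ 1) → ∀ {r} → IsZeroDivisor Q r → ∃ λ i → p i ∣ r
    squarefree-zeroDivisor⇒p∣ m≡1 {r} (s , s≉0 , rs≈0) = decidable-stable em λ ¬∃ →
      s≉0 (∣⇒≈0 (squarefree-g∣-intro m≡1 λ i →
        [ (λ p∣r → contradiction (i , p∣r) ¬∃) , (λ p∣s → p∣s) ]′
          (Prime.split-∣ (p-prime i) (∣ʳ-trans (p∣g i) (≈0⇒∣ rs≈0)))))

    twoResidues⇒0dimension : k ≡ 1 → (∀ i → m i ≡ 1) → (∀ i → HasTwoResidues (p i)) →
      IsIntersectionOfThresholdGraphs Γ 0
    twoResidues⇒0dimension k≡1 m≡1 two = isIntersectionOfThresholdGraphs Γ (λ ()) (λ ()) (λ ())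
      λ (r , r-zd , r≉0) (s , s-zd , s≉0) r≉s → mk⇔ (λ _ ()) λ _ → r≉s , ∣⇒≈0
        (g∣rs (squarefree-zeroDivisor⇒p∣ m≡1 r-zd) (squarefree-zeroDivisor⇒p∣ m≡1 s-zd)
          (r≉0 ∘ ∣⇒≈0) (s≉0 ∘ ∣⇒≈0) r≉s)
      where
      g∣ : ∀ {i j x} → i ≢ j → p i ∣ x → p j ∣ x → g ∣ x
      g∣ {x = x} i≢j pᵢ∣x pⱼ∣x = squarefree-g∣-intro m≡1 λ l →
        [ (λ eq → ≡.subst (λ i → p i ∣ x) eq pᵢ∣x) , (λ eq → ≡.subst (λ i → p i ∣ x) eq pⱼ∣x) ]′
          (oneOfTwo k≡1 i≢j l)

      g∣rs : ∀ {r s} → (∃ λ i → p i ∣ r) → (∃ λ j → p j ∣ s) →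
        ¬ g ∣ r → ¬ g ∣ s → ¬ r ≈ s [mod g ] → g ∣ r * s
      g∣rs {r} {s} (i , p∣r) (j , p∣s) g∤r g∤s r≉s with i Fin.≟ j
      ... | no i≢j = g∣ i≢j (x∣y⇒x∣yz s p∣r) (x∣ʳy⇒x∣ʳzy r p∣s)
      -- Both vertices are multiples of `p i` and, being nonzero in `Q`, not of the other prime
      -- `p l`. Two residues modulo `p l` then force `r` and `s` to be equal in `Q`.
      ... | yes ≡.refl = contradiction
        (g∣ i≢l (Mod.trans (p i) {r} {0#} {s} (∣⇒≈0 p∣r) (Mod.sym (p i) {s} {0#} (∣⇒≈0 p∣s)))
          (twoResidues⇒≈ {x = r} {s} (two l) (g∤r ∘ g∣ i≢l p∣r) (g∤s ∘ g∣ i≢l p∣s)))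
        r≉s
        where
        l = proj₁ (another (ℕ.≤-reflexive (≡.sym k≡1)) i)
        i≢l = proj₂ (another (ℕ.≤-reflexive (≡.sym k≡1)) i)

theorem80 :
  {c ℓ : Level} (R : CommutativeRing c ℓ) →
  let open CommutativeRing R
      open RingTheory R
  in
  IsPrincipalIdealDomain →
  (g : Carrier) →
  let Q = Quotient ⟨ g ⟩
  in
  IsProper ⟨ g ⟩ →
  ¬ IsPrimeIdeal ⟨ g ⟩ →
  IsFinite (CommutativeRing.setoid Q) →
  (n : ℕ) (u : Carrier) (p : Fin n → Carrier) (m : Fin n → ℕ) →
  IsUnit u →
  (∀ i → Prime (p i)) →
  (∀ i j → i ≢ j → p i ∦ p j) →
  (∀ i → m i ≥ 1) →
  g ≈ u * product (λ i → p i ^ m i) →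
  n ≥ 2 →
  let Γ = zeroDivisorGraph Q
      residueRing = λ i → CommutativeRing.setoid (Quotient ⟨ p i ⟩)
  in
  ((∃ λ i → m i ≥ 2) →
    HasThresholdDimension Γ n)
  ×
  ((∀ i → HasCardinality≥ (residueRing i) 3) →
    HasThresholdDimension Γ n)
  ×
  (n ≥ 3 → (∀ i → m i ≡ 1) → (∃ λ i → HasCardinality (residueRing i) 2) →
    HasThresholdDimension Γ (n ∸ 1))
  ×
  (n ≡ 2 → (∀ i → m i ≡ 1) → ∃! _≡_ (λ i → HasCardinality (residueRing i) 2) →
    HasThresholdDimension Γ 1)
  ×
  (n ≡ 2 → (∀ i → m i ≡ 1) → (∀ i → HasCardinality (residueRing i) 2) →
    HasThresholdDimension Γ 0)
theorem80 R pid g _ _ _ (suc (suc k)) u p m u-unit p-prime p∦p m≥1 g≈up (ℕ.s≤s (ℕ.s≤s _)) =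
    (λ (_ , mᵢ≥2) → dimension≤ , nonSquarefree⇒≤dimension mᵢ≥2 (ℕ.s≤s ℕ.z≤n))
  , (λ three → dimension≤ , thirdResidues⇒≤dimension (ℕ.s≤s ℕ.z≤n)
      λ i → threeResidues⇒thirdResidue (p-prime i) (three i))
  , (λ n≥3 m≡1 (i , two) → squarefreeDimension≤ m≡1 i two , pred≤dimension (ℕ.s≤s⁻¹ n≥3))
  , (λ { ≡.refl m≡1 (i , two , unique) → squarefreeDimension≤ m≡1 i two ,
      let j , i≢j = another (ℕ.s≤s ℕ.z≤n) i
      -- By uniqueness of `i`, the other residue ring does not have two elements, so it has a third
      -- residue.
      in thirdResidue⇒1≤dimension (i≢j ∘ ≡.sym)
           (¬twoResidues⇒thirdResidue (p-prime j) (i≢j ∘ unique)) })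
  , (λ n≡2 m≡1 two → twoResidues⇒0dimension (ℕ.suc-injective n≡2) m≡1 two , λ _ _ → ℕ.z≤n)
  where
  open PID R pid
  open Factorization g (suc k) u p m u-unit p-prime p∦p m≥1 g≈up
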